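{- The grid graph $P_3\square P_3\square P_3$ is not a PCG.
   Context: All graphs are finite, simple, and undirected. A weighted tree is a finite tree with strictly positive real edge weights. For a weighted tree $T$ and vertices $x,y$ of $T$, $d_T(x,y)$ is the total weight of the unique $x$–$y$ path, and $L(T)$ is the set of leaves of $T$. The grid graph $P_3\square P_3\square P_3$ has vertex set $\{0,1,2\}^3$; two vertices are adjacent if and only if they differ by $1$ in exactly one coordinate and agree in the other two coordinates. PCG (pairwise compatibility graph): a graph $G=(V,E)$ is a PCG if there exist a weighted tree $T$, a bijection $\zeta:V\to L(T)$, and real numbers $0\le d_{\min}\le d_{\max}$ such that for every pair of distinct vertices $u,v\in V$, $uv\in E$ if and only if $d_{\min}\le d_T(\zeta(u),\zeta(v))\le d_{\max}$. -}

module Defs where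

open import Data.Fin using (Fin; toℕ)
import Data.Fin.Properties as Fin
open import Data.List using (List; []; _∷_)
open import Data.List.Relation.Unary.Unique.Propositional using (Unique)
open import Data.Nat as ℕ using (ℕ; suc; _⊔_; ∣_-_∣)
import Data.Nat.Properties as ℕ
open import Data.Product using (Σ; ∃; ∃!; _×_; _,_; proj₁; proj₂)
open import Data.Product.Function.NonDependent.Propositional using (_×-↔_)
open import Data.Rational as ℚ using (ℚ; 0ℚ; ½)
import Data.Rational.Properties as ℚ
import Data.Rational.Solver as ℚ
open import Data.Sum as Sum using (_⊎_)
open import Function using (_∘_; _on_)
open import Function.Bundles using (_↔_; _⇔_)
open import Function.Construct.Identity using (↔-id)
open import Function.Construct.Symmetry using (↔-sym)
open import Function.Construct.Composition using (_↔-∘_)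
open import Function.Definitions using (Bijective)
open import Relation.Binary.Construct.Closure.ReflexiveTransitive using (Star; ε; _◅_)
open import Relation.Binary.Definitions using (Decidable; Symmetric; Irreflexive)
open import Relation.Binary.PropositionalEquality
  using (_≡_; _≢_; refl; sym; trans; cong; subst)
open import Relation.Nullary using (¬_)
open import Relation.Nullary.Decidable using (_×-dec_; _⊎-dec_)

-- Real numbers: Cauchy sequences of rationals, compared by the setoid
-- equality _≈_ below.

record ℝ : Set where
  field
    seq    : ℕ → ℚ
    cauchy : ∀ e → 0ℚ ℚ.< e →
             ∃ λ N → ∀ m n → N ℕ.≤ m → N ℕ.≤ n → ℚ.∣ seq m ℚ.- seq n ∣ ℚ.< e

open ℝ public

0ℝ : ℝ
0ℝ = record { seq = λ _ → 0ℚ ; cauchy = λ _ 0<e → 0 , λ _ _ _ _ → 0<e }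

private
  half-pos : ∀ e → 0ℚ ℚ.< e → 0ℚ ℚ.< ½ ℚ.* e
  half-pos e 0<e = subst (ℚ._< ½ ℚ.* e) (ℚ.*-zeroʳ ½) (ℚ.*-monoʳ-<-pos ½ 0<e)

  halves : ∀ e → ½ ℚ.* e ℚ.+ ½ ℚ.* e ≡ e
  halves e = trans (sym (ℚ.*-distribʳ-+ e ½ ½)) (ℚ.*-identityˡ e)

  interchange : ∀ a b c d → (a ℚ.+ b) ℚ.- (c ℚ.+ d) ≡ (a ℚ.- c) ℚ.+ (b ℚ.- d)
  interchange = solve 4 (λ a b c d → (a :+ b) :- (c :+ d) := (a :- c) :+ (b :- d)) refl
    where open ℚ.+-*-Solver

infixl 6 _+ℝ_
_+ℝ_ : ℝ → ℝ → ℝ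
seq    (x +ℝ y) n = seq x n ℚ.+ seq y n
cauchy (x +ℝ y) e 0<e
  with cauchy x (½ ℚ.* e) (half-pos e 0<e) | cauchy y (½ ℚ.* e) (half-pos e 0<e)
... | M , close-x | N , close-y = M ⊔ N , λ m n ≤m ≤n → begin-strict
  ℚ.∣ (seq x m ℚ.+ seq y m) ℚ.- (seq x n ℚ.+ seq y n) ∣
    ≡⟨ cong ℚ.∣_∣ (interchange (seq x m) (seq y m) (seq x n) (seq y n)) ⟩
  ℚ.∣ (seq x m ℚ.- seq x n) ℚ.+ (seq y m ℚ.- seq y n) ∣
    ≤⟨ ℚ.∣p+q∣≤∣p∣+∣q∣ (seq x m ℚ.- seq x n) (seq y m ℚ.- seq y n) ⟩
  ℚ.∣ seq x m ℚ.- seq x n ∣ ℚ.+ ℚ.∣ seq y m ℚ.- seq y n ∣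
    <⟨ ℚ.+-mono-< (close-x m n (ℕ.m⊔n≤o⇒m≤o M N ≤m) (ℕ.m⊔n≤o⇒m≤o M N ≤n))
                  (close-y m n (ℕ.m⊔n≤o⇒n≤o M N ≤m) (ℕ.m⊔n≤o⇒n≤o M N ≤n)) ⟩
  ½ ℚ.* e ℚ.+ ½ ℚ.* e
    ≡⟨ halves e ⟩
  e ∎
  where open ℚ.≤-Reasoning

infix 4 _<ℝ_ _≤ℝ_ _≈ℝ_

-- A gap bounded away from 0: termwise < would not respect _≈ℝ_.
_<ℝ_ : ℝ → ℝ → Set
x <ℝ y = ∃ λ e → 0ℚ ℚ.< e × ∃ λ N → ∀ n → N ℕ.≤ n → seq x n ℚ.+ e ℚ.< seq y n

_≤ℝ_ : ℝ → ℝ → Set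
x ≤ℝ y = ¬ (y <ℝ x)

_≈ℝ_ : ℝ → ℝ → Set
x ≈ℝ y = x ≤ℝ y × y ≤ℝ x

record Graph : Set₁ where
  infix 4 _~_ _~?_
  field
    V        : Set
    order    : ℕ
    finite   : V ↔ Fin order
    _~_      : V → V → Set
    _~?_     : Decidable _~_
    ~-sym    : Symmetric _~_
    ~-irrefl : Irreflexive _≡_ _~_

module _ (G : Graph) where
  open Graph G

  Walk : V → V → Set
  Walk = Star _~_

  vertices : ∀ {x y} → Walk x y → List V
  vertices {x} ε       = x ∷ []
  vertices {x} (_ ◅ p) = x ∷ vertices p

  edgeCount : ∀ {x y} → Walk x y → ℕ
  edgeCount ε       = 0
  edgeCount (_ ◅ p) = suc (edgeCount p)

  Path : V → V → Set
  Path x y = Σ (Walk x y) (Unique ∘ vertices)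

  -- A cycle is a path on at least three vertices together with an edge
  -- joining its two ends.
  Acyclic : Set
  Acyclic = ∀ {x y} (p : Path x y) → 2 ℕ.≤ edgeCount (proj₁ p) → ¬ (y ~ x)

  record IsTree : Set where
    field
      nonempty  : V
      connected : ∀ x y → Path x y
      acyclic   : Acyclic

  IsLeaf : V → Set
  IsLeaf x = ∃! _≡_ (x ~_)

-- Weights are given on all pairs of vertices, but only the values on edges
-- are constrained or used.
record WeightedTree : Set₁ where
  field
    graph      : Graph
    isTree     : IsTree graph
  open Graph graph public
  open IsTree isTree public
  field
    weight     : V → V → ℝ
    weight-sym : ∀ {x y} → x ~ y → weight x y ≈ℝ weight y x
    weight-pos : ∀ {x y} → x ~ y → 0ℝ <ℝ weight x y

  walkWeight : ∀ {x y} → Walk graph x y → ℝ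
  walkWeight ε                   = 0ℝ
  walkWeight (_◅_ {x} {y} _ p) = weight x y +ℝ walkWeight p

  -- In an acyclic graph the path supplied by connectedness is the only one.
  dist : V → V → ℝ
  dist x y = walkWeight (proj₁ (connected x y))

  Leaf : Set
  Leaf = Σ V (IsLeaf graph)

  -- Leaves are compared as vertices, ignoring the proof of leafhood.
  _≡ᴸ_ : Leaf → Leaf → Set
  _≡ᴸ_ = _≡_ on proj₁

record IsPCG (G : Graph) : Set₁ where
  open Graph G using (V; _~_)
  field
    tree : WeightedTree
  open WeightedTree tree using (Leaf; _≡ᴸ_; dist)
  field
    ζ           : V → Leaf
    ζ-bijective : Bijective _≡_ _≡ᴸ_ ζ
    dmin dmax   : ℝ
    0≤dmin      : 0ℝ ≤ℝ dmin
    dmin≤dmax   : dmin ≤ℝ dmax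
    adjacency   : ∀ u v → u ≢ v →
                  (u ~ v) ⇔ (dmin ≤ℝ dist (proj₁ (ζ u)) (proj₁ (ζ v)) ×
                             dist (proj₁ (ζ u)) (proj₁ (ζ v)) ≤ℝ dmax)

GridVertex : Set
GridVertex = Fin 3 × Fin 3 × Fin 3

DifferBy1 : Fin 3 → Fin 3 → Set
DifferBy1 i j = ∣ toℕ i - toℕ j ∣ ≡ 1

GridAdj : GridVertex → GridVertex → Set
GridAdj (a , b , c) (a′ , b′ , c′) =
  (DifferBy1 a a′ × b ≡ b′ × c ≡ c′) ⊎
  (a ≡ a′ × DifferBy1 b b′ × c ≡ c′) ⊎
  (a ≡ a′ × b ≡ b′ × DifferBy1 c c′)

private
  differBy1? : Decidable DifferBy1
  differBy1? i j = ∣ toℕ i - toℕ j ∣ ℕ.≟ 1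

  differBy1-sym : Symmetric DifferBy1
  differBy1-sym {i} {j} = trans (ℕ.∣-∣-comm (toℕ j) (toℕ i))

  differBy1-irrefl : ∀ i → ¬ DifferBy1 i i
  differBy1-irrefl i d with trans (sym (ℕ.∣n-n∣≡0 (toℕ i))) d
  ... | ()

P₃□P₃□P₃ : Graph
P₃□P₃□P₃ = record
  { V        = GridVertex
  ; order    = 27
  ; finite   = ↔-sym (Fin.*↔× {3} {9}) ↔-∘ (↔-id (Fin 3) ×-↔ ↔-sym (Fin.*↔× {3} {3}))
  ; _~_      = GridAdj
  ; _~?_     = λ (a , b , c) (a′ , b′ , c′) →
      (differBy1? a a′ ×-dec b Fin.≟ b′ ×-dec c Fin.≟ c′) ⊎-dec
      (a Fin.≟ a′ ×-dec differBy1? b b′ ×-dec c Fin.≟ c′) ⊎-dec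
      (a Fin.≟ a′ ×-dec b Fin.≟ b′ ×-dec differBy1? c c′)
  ; ~-sym    = λ {(a , b , c)} {(a′ , b′ , c′)} → Sum.map
      (λ (d , p , q) → differBy1-sym {a} {a′} d , sym p , sym q)
      (Sum.map
        (λ (p , d , q) → sym p , differBy1-sym {b} {b′} d , sym q)
        (λ (p , q , d) → sym p , sym q , differBy1-sym {c} {c′} d))
  ; ~-irrefl = λ { {a , b , c} refl → Sum.[ (λ (d , _) → differBy1-irrefl a d)
                 , Sum.[ (λ (_ , d , _) → differBy1-irrefl b d)
                       , (λ (_ , _ , d) → differBy1-irrefl c d) ] ] }
  }

{-# OPTIONS --safe #-}

-- Fix a leaf t of a weighted tree. The lengths of the common prefixes of the
-- paths from t form an ultrametric, and this is the four-point condition for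
-- the distance d. Four instances of it give an inequality between the edges and
-- the long diagonals of a hexagon of leaves (hexagon below).
--
-- Colour a pair of leaves red when d < dmin, blue when dmax < d. In a PCG the
-- edges have neither colour and every non-edge has one, while the hexagon
-- inequality forbids a hexagon whose long diagonals dominate its edges in
-- colour. No colouring of the non-edges of the grid avoids all such hexagons:
-- this is shown by a list of colour patterns, each one excluded by unit
-- propagation from hexagons and from images of earlier patterns under the
-- automorphisms of the grid.
--
-- The real distances are first replaced by rational approximations, which is
-- harmless because strict inequalities leave a margin.

module Submission where

open import Defs
open import Data.Bool using (Bool; true; false; T; not; _∧_; _∨_; if_then_else_)
open import Data.Bool.Properties using (T-∧; T-∨)
open import Data.Empty using (⊥-elim)
open import Data.Fin using (Fin; zero; suc; toℕ; opposite)
import Data.Fin.Properties as Fin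
open import Data.List using (List; []; _∷_; _++_; map; filterᵇ)
open import Data.List.Membership.Propositional using (_∈_; _∉_)
open import Data.List.Relation.Binary.Subset.Propositional using (_⊆_)
open import Data.List.Relation.Unary.All as All using (All; []; _∷_)
import Data.List.Relation.Unary.All.Properties as All
open import Data.List.Relation.Unary.AllPairs using ([]; _∷_)
open import Data.List.Relation.Unary.Any using (here; there; any?)
open import Data.List.Relation.Unary.Unique.Propositional using (Unique)
open import Data.Maybe as Maybe using (Maybe; just; nothing)
open import Data.Nat as ℕ using (ℕ; suc; _⊔_; _≡ᵇ_; _≤ᵇ_; ∣_-_∣; s≤s; z≤n)
import Data.Nat.DivMod as ℕ
import Data.Nat.Properties as ℕ
open import Data.Product using (Σ; ∃; _×_; _,_; proj₁; proj₂)
open import Data.Product.Properties using (≡-dec)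
open import Data.Rational as ℚ using (ℚ; 0ℚ; 1ℚ; ½)
import Data.Rational.Properties as ℚ
open import Data.Rational.Solver using (module +-*-Solver)
open import Data.Sum as Sum using (_⊎_; inj₁; inj₂)
open import Data.Unit using (tt)
open import Function using (_∘_; id)
open import Function.Bundles using (module Inverse; module Injection; module Equivalence)
open import Function.Properties.Inverse using (↔⇒↣)
open import Relation.Binary.Construct.Closure.ReflexiveTransitive using (ε; _◅_; _◅◅_)
open import Relation.Binary.Definitions using (DecidableEquality)
open import Relation.Binary.PropositionalEquality
  using (_≡_; _≢_; refl; sym; trans; cong; cong₂; subst; subst₂)
open import Relation.Nullary using (¬_; Dec; yes; no; does)
open import Relation.Nullary.Decidable using (toWitness; via-injection; _→-dec_)

open +-*-Solver

-- Rational arithmetic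

+-cancelʳ-≤ : ∀ r {p q} → p ℚ.+ r ℚ.≤ q ℚ.+ r → p ℚ.≤ q
+-cancelʳ-≤ r {p} {q} p+r≤q+r =
  subst₂ ℚ._≤_ (undo p) (undo q) (ℚ.+-monoˡ-≤ (ℚ.- r) p+r≤q+r)
  where
  undo : ∀ a → (a ℚ.+ r) ℚ.- r ≡ a
  undo a = solve 2 (λ a r → (a :+ r) :- r := a) refl a r

½* : ℚ → ℚ
½* e = ½ ℚ.* e

½*-pos : ∀ {e} → 0ℚ ℚ.< e → 0ℚ ℚ.< ½* e
½*-pos {e} 0<e = subst (ℚ._< ½* e) (ℚ.*-zeroʳ ½) (ℚ.*-monoʳ-<-pos ½ 0<e)

½+½ : ∀ e → ½* e ℚ.+ ½* e ≡ e
½+½ e = trans (sym (ℚ.*-distribʳ-+ e ½ ½)) (ℚ.*-identityˡ e)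

p≤∣p∣ : ∀ p → p ℚ.≤ ℚ.∣ p ∣
p≤∣p∣ p with ℚ.≤-total 0ℚ p
... | inj₁ 0≤p = ℚ.≤-reflexive (sym (ℚ.0≤p⇒∣p∣≡p 0≤p))
... | inj₂ p≤0 = ℚ.≤-trans p≤0 (ℚ.0≤∣p∣ p)

∣-∣<⇒≤+ : ∀ {p q e} → ℚ.∣ p ℚ.- q ∣ ℚ.< e → p ℚ.≤ q ℚ.+ e
∣-∣<⇒≤+ {p} {q} {e} close = begin
  p                  ≡⟨ solve 2 (λ p q → p := q :+ (p :- q)) refl p q ⟩
  q ℚ.+ (p ℚ.- q)    ≤⟨ ℚ.+-monoʳ-≤ q (p≤∣p∣ (p ℚ.- q)) ⟩
  q ℚ.+ ℚ.∣ p ℚ.- q ∣ ≤⟨ ℚ.+-monoʳ-≤ q (ℚ.<⇒≤ close) ⟩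
  q ℚ.+ e ∎
  where open ℚ.≤-Reasoning

-- Walks and paths in a tree

module TreePaths (G : Graph) (tree : IsTree G) where
  open Graph G
  open IsTree tree

  infix 4 _≟_
  _≟_ : DecidableEquality V
  _≟_ = via-injection (↔⇒↣ finite) Fin._≟_

  verts : ∀ {x y} → Walk G x y → List V
  verts = vertices G

  start∈ : ∀ {x y} (p : Walk G x y) → x ∈ verts p
  start∈ ε       = here refl
  start∈ (_ ◅ _) = here refl

  end∈ : ∀ {x y} (p : Walk G x y) → y ∈ verts p
  end∈ ε       = here refl
  end∈ (_ ◅ p) = there (end∈ p)

  cons-path : ∀ {x y z} (e : x ~ y) (p : Walk G y z) → x ∉ verts p →
              Unique (verts p) → Unique (verts (e ◅ p))
  cons-path e p x∉p u = All.¬Any⇒All¬ _ x∉p ∷ u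

  head∉ : ∀ {x y z} (e : x ~ y) (p : Walk G y z) →
          Unique (verts (e ◅ p)) → x ∉ verts p
  head∉ e p (x≢ ∷ _) = All.All¬⇒¬Any x≢

  suffix : ∀ {x y z} (p : Walk G x y) → Unique (verts p) → z ∈ verts p →
           Σ (Path G z y) λ q → verts (proj₁ q) ⊆ verts p
  suffix ε       u       (here refl) = (ε , u) , id
  suffix (e ◅ p) u       (here refl) = (e ◅ p , u) , id
  suffix (e ◅ p) (_ ∷ u) (there z∈p) with suffix p u z∈p
  ... | q , q⊆p = q , there ∘ q⊆p

  prefix : ∀ {x y z} (p : Walk G x y) → z ∈ verts p →
           Σ (Walk G x z) λ q → verts q ⊆ verts p
  prefix ε       (here refl) = ε , id
  prefix (e ◅ p) (here refl) = ε , λ { (here refl) → here refl }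
  prefix (e ◅ p) (there z∈p) with prefix p z∈p
  ... | q , q⊆p = e ◅ q , λ { (here refl) → here refl ; (there i) → there (q⊆p i) }

  -- When the new first vertex recurs in the erased remainder, everything before the recurrence is
  -- dropped. The inclusion of vertex sets lets a later argument keep a forbidden vertex out of the
  -- result.
  loop-erase : ∀ {x y} (p : Walk G x y) → Σ (Path G x y) λ q → verts (proj₁ q) ⊆ verts p
  loop-erase ε = (ε , [] ∷ []) , id
  loop-erase (_◅_ {x} e p) with loop-erase p
  ... | (q , u) , q⊆p with any? (x ≟_) (verts q)
  ...   | no x∉q = (e ◅ q , cons-path e q x∉q u)
                 , λ { (here refl) → here refl ; (there i) → there (q⊆p i) }
  ...   | yes x∈q with suffix q u x∈q
  ...     | r , r⊆q = r , there ∘ q⊆p ∘ r⊆q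

  ∈-◅◅ : ∀ {x y z v} (p : Walk G x y) (q : Walk G y z) →
         v ∈ verts (p ◅◅ q) → v ∈ verts p ⊎ v ∈ verts q
  ∈-◅◅ ε       q i           = inj₂ i
  ∈-◅◅ (e ◅ p) q (here refl) = inj₁ (here refl)
  ∈-◅◅ (e ◅ p) q (there i)   = Sum.map₁ there (∈-◅◅ p q i)

  -- Reversal with an accumulator: the steps of `p` move one at a time to the front of `q`. With `ε`
  -- for `q` it is plain reversal.
  reverse-◅◅ : ∀ {x y z} → Walk G x y → Walk G x z → Walk G y z
  reverse-◅◅ ε       q = q
  reverse-◅◅ (e ◅ p) q = reverse-◅◅ p (~-sym e ◅ q)

  ∈-reverse-◅◅ : ∀ {x y z v} (p : Walk G x y) (q : Walk G x z) →
                 v ∈ verts (reverse-◅◅ p q) → v ∈ verts p ⊎ v ∈ verts q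
  ∈-reverse-◅◅ ε       q i = inj₂ i
  ∈-reverse-◅◅ (e ◅ p) q i with ∈-reverse-◅◅ p (~-sym e ◅ q) i
  ... | inj₁ j           = inj₁ (there j)
  ... | inj₂ (here refl) = inj₁ (there (start∈ p))
  ... | inj₂ (there j)   = inj₂ j

  -- Otherwise loop-erasing p followed by the reverse of q, which avoids x,
  -- would close up through x to a cycle.
  no-detour : ∀ {x y z v} → x ~ y → x ~ z → y ≢ z →
              (p : Walk G y v) (q : Walk G z v) → x ∉ verts p → x ∉ verts q → ∀ {A : Set} → A
  no-detour {x} {y} {z} x~y x~z y≢z p q x∉p x∉q
    with loop-erase (p ◅◅ reverse-◅◅ q ε)
  ... | (r , u) , r⊆ = ⊥-elim (acyclic (x~y ◅ r , cons-path x~y r x∉r u) (long r) (~-sym x~z))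
    where
    long : (r : Walk G y z) → 2 ℕ.≤ edgeCount G (x~y ◅ r)
    long ε       = ⊥-elim (y≢z refl)
    long (_ ◅ _) = s≤s (s≤s z≤n)
    x∉r : x ∉ verts r
    x∉r i with ∈-◅◅ p _ (r⊆ i)
    ... | inj₁ j = x∉p j
    ... | inj₂ j with ∈-reverse-◅◅ q ε j
    ...   | inj₁ k = x∉q k
    ...   | inj₂ (here refl) = x∉q (start∈ q)

  -- If the first steps differ, the remainders reach the same end without returning to the start,
  -- against `no-detour`. Only vertex lists are compared, since walks may differ in their proofs of
  -- adjacency.
  path-unique : ∀ {x y} (p q : Walk G x y) → Unique (verts p) → Unique (verts q) →
                verts p ≡ verts q
  path-unique ε       ε       _ _ = refl
  path-unique ε       (e ◅ q) _ u = ⊥-elim (head∉ e q u (end∈ q))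
  path-unique (e ◅ p) ε       u _ = ⊥-elim (head∉ e p u (end∈ p))
  path-unique (_◅_ {_} {y} e p) (_◅_ {_} {z} f q) u@(_ ∷ u′) v@(_ ∷ v′) with y ≟ z
  ... | yes refl = cong (_ ∷_) (path-unique p q u′ v′)
  ... | no y≢z   = no-detour e f y≢z p q (head∉ e p u) (head∉ f q v)

  -- Moving the first step of `p` over to `q` shifts the only common vertex from `x` to `y`. The
  -- vertex `y` is not yet in `q`: it would equal `x`, which `p` does not revisit.
  reverse-◅◅-path : ∀ {x y z} (p : Walk G x y) (q : Walk G x z) →
                    Unique (verts p) → Unique (verts q) →
                    (∀ {v} → v ∈ verts p → v ∈ verts q → v ≡ x) →
                    Unique (verts (reverse-◅◅ p q))
  reverse-◅◅-path ε       q _ u _ = u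
  reverse-◅◅-path {x} (_◅_ {_} {y} e p) q u@(_ ∷ u′) v meet =
    reverse-◅◅-path p (~-sym e ◅ q) u′ (cons-path (~-sym e) q y∉q v) meet′
    where
    y∉q : y ∉ verts q
    y∉q i = head∉ e p u (subst (_∈ verts p) (meet (there (start∈ p)) i) (start∈ p))
    meet′ : ∀ {t} → t ∈ verts p → t ∈ y ∷ verts q → t ≡ y
    meet′ i (here t≡y) = t≡y
    meet′ i (there j)  = ⊥-elim (head∉ e p u (subst (_∈ verts p) (meet (there i) j) i))

  -- Tree distances and the four-point condition

  module TreeMetric (w : V → V → ℚ) (w-sym : ∀ x y → w x y ≡ w y x)
                    (w-nonneg : ∀ x y → 0ℚ ℚ.≤ w x y) where
    -- Defined on vertex lists, because `path-unique` equates only those.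
    length : List V → ℚ
    length []          = 0ℚ
    length (x ∷ [])    = 0ℚ
    length (x ∷ y ∷ l) = w x y ℚ.+ length (y ∷ l)

    d : V → V → ℚ
    d x y = length (verts (proj₁ (connected x y)))

    d-path : ∀ {x y} (p : Path G x y) → length (verts (proj₁ p)) ≡ d x y
    d-path {x} {y} (p , u) = cong length (path-unique p _ u (proj₂ (connected x y)))

    length-◅ : ∀ {x y z} (e : x ~ y) (p : Walk G y z) →
               length (verts (e ◅ p)) ≡ w x y ℚ.+ length (verts p)
    length-◅ e ε       = refl
    length-◅ e (_ ◅ _) = refl

    length-reverse-◅◅ : ∀ {x y z} (p : Walk G x y) (q : Walk G x z) →
      length (verts (reverse-◅◅ p q)) ≡ length (verts p) ℚ.+ length (verts q)
    length-reverse-◅◅ ε       q = sym (ℚ.+-identityˡ _)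
    length-reverse-◅◅ {x} (_◅_ {_} {y} e p) q
      rewrite length-reverse-◅◅ p (~-sym e ◅ q) | length-◅ (~-sym e) q | length-◅ e p | w-sym y x =
      solve 3 (λ a b c → b :+ (a :+ c) := (a :+ b) :+ c) refl
        (w x y) (length (verts p)) (length (verts q))

    -- The length of the common prefix of x ∷ l and x ∷ m.
    shared : (x : V) (l m : List V) → ℚ
    shared x (y ∷ l) (z ∷ m) with y ≟ z
    ... | yes _ = w x y ℚ.+ shared y l m
    ... | no  _ = 0ℚ
    shared x _ _ = 0ℚ

    shared-nonneg : ∀ x l m → 0ℚ ℚ.≤ shared x l m
    shared-nonneg x []      m       = ℚ.≤-refl
    shared-nonneg x (y ∷ l) []      = ℚ.≤-refl
    shared-nonneg x (y ∷ l) (z ∷ m) with y ≟ z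
    ... | yes _ = ℚ.+-mono-≤ (w-nonneg x y) (shared-nonneg y l m)
    ... | no  _ = ℚ.≤-refl

    -- Where `l` and `n` part, `m` has to leave at least one of them, and its common prefix with
    -- that one is then no longer.
    shared-ultra : ∀ x l m n → shared x l m ℚ.≤ shared x l n ⊎ shared x m n ℚ.≤ shared x l n
    shared-ultra x []      m       n  = inj₁ ℚ.≤-refl
    shared-ultra x (y ∷ l) []      n  = inj₁ (shared-nonneg x (y ∷ l) n)
    shared-ultra x (y ∷ l) (z ∷ m) [] = inj₂ ℚ.≤-refl
    shared-ultra x (y ∷ l) (z ∷ m) (t ∷ n) with y ≟ t | y ≟ z | z ≟ t
    ... | yes refl | yes refl | yes _  = Sum.map (ℚ.+-monoʳ-≤ (w x y)) (ℚ.+-monoʳ-≤ (w x y))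
                                           (shared-ultra y l m n)
    ... | yes refl | yes refl | no y≢y = ⊥-elim (y≢y refl)
    ... | yes refl | no _     | _      =
      inj₁ (ℚ.+-mono-≤ (w-nonneg x y) (shared-nonneg y l n))
    ... | no y≢t   | no _     | _      = inj₁ ℚ.≤-refl
    ... | no y≢t   | yes refl | yes q  = ⊥-elim (y≢t q)
    ... | no y≢t   | yes refl | no _   = inj₂ ℚ.≤-refl

    shared-[]ʳ : ∀ x l → shared x l [] ≡ 0ℚ
    shared-[]ʳ x []      = refl
    shared-[]ʳ x (_ ∷ _) = refl

    shared-sym : ∀ x l m → shared x l m ≡ shared x m l
    shared-sym x []      []      = refl
    shared-sym x []      (_ ∷ _) = refl
    shared-sym x (_ ∷ _) []      = refl
    shared-sym x (y ∷ l) (z ∷ m) with y ≟ z | z ≟ y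
    ... | yes refl | yes _  = cong (w x y ℚ.+_) (shared-sym y l m)
    ... | yes y≡z  | no z≢y = ⊥-elim (z≢y (sym y≡z))
    ... | no y≢z   | yes z≡y = ⊥-elim (y≢z (sym z≡y))
    ... | no _     | no _   = refl

    steps : ∀ {x y} → Walk G x y → List V
    steps ε       = []
    steps (_ ◅ p) = verts p

    verts-steps : ∀ {x y} (p : Walk G x y) → verts p ≡ x ∷ steps p
    verts-steps ε       = refl
    verts-steps (_ ◅ _) = refl

    shared-same : ∀ r {a x y} (p : Walk G a x) (q : Walk G a y) →
                  shared r (verts p) (verts q) ≡ w r a ℚ.+ shared a (steps p) (steps q)
    shared-same r {a} p q rewrite verts-steps p | verts-steps q with a ≟ a
    ... | yes _  = refl
    ... | no a≢a = ⊥-elim (a≢a refl)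

    shared-diff : ∀ r {a b x y} → a ≢ b → (p : Walk G a x) (q : Walk G b y) →
                  shared r (verts p) (verts q) ≡ 0ℚ
    shared-diff r {a} {b} a≢b p q rewrite verts-steps p | verts-steps q with a ≟ b
    ... | yes a≡b = ⊥-elim (a≢b a≡b)
    ... | no _    = refl

    d-fork : ∀ {r x y} (p : Walk G r x) (q : Walk G r y) →
             Unique (verts p) → Unique (verts q) →
             (∀ {v} → v ∈ verts p → v ∈ verts q → v ≡ r) →
             d x y ≡ length (verts p) ℚ.+ length (verts q)
    d-fork p q u v meet =
      trans (sym (d-path (reverse-◅◅ p q , reverse-◅◅-path p q u v meet)))
            (length-reverse-◅◅ p q)

    -- A common first edge adds twice its weight to both sides. Once the first steps differ,
    -- `no-detour` shows that the paths meet only at `r`, so joining them there gives a path.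
    d-meet : ∀ {r x y} (p : Walk G r x) (q : Walk G r y) →
             Unique (verts p) → Unique (verts q) →
             let s = shared r (steps p) (steps q) in
             d x y ℚ.+ (s ℚ.+ s) ≡ length (verts p) ℚ.+ length (verts q)
    d-meet ε q u v = trans (ℚ.+-identityʳ _) (d-fork ε q u v λ { (here refl) _ → refl })
    d-meet {r} (e ◅ p) ε u v rewrite shared-[]ʳ r (verts p) =
      trans (ℚ.+-identityʳ _) (d-fork (e ◅ p) ε u v λ { _ (here refl) → refl })
    d-meet {r} {x} {y} (_◅_ {_} {a} e p) (_◅_ {_} {b} f q) u@(_ ∷ u′) v@(_ ∷ v′) with a ≟ b
    ... | yes refl rewrite shared-same r p q | length-◅ e p | length-◅ f q =
      trans (solve 3 (λ D W S → D :+ ((W :+ S) :+ (W :+ S)) := (D :+ (S :+ S)) :+ (W :+ W)) refl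
              (d x y) (w r a) (shared a (steps p) (steps q)))
        (trans (cong (ℚ._+ (w r a ℚ.+ w r a)) (d-meet p q u′ v′))
          (solve 3 (λ P Q W → (P :+ Q) :+ (W :+ W) := (W :+ P) :+ (W :+ Q)) refl
            (length (verts p)) (length (verts q)) (w r a)))
    ... | no a≢b rewrite shared-diff r a≢b p q =
      trans (ℚ.+-identityʳ _) (d-fork (e ◅ p) (f ◅ q) u v meet)
      where
      meet : ∀ {v} → v ∈ verts (e ◅ p) → v ∈ verts (f ◅ q) → v ≡ r
      meet (here t≡r) _          = t≡r
      meet (there i)  (here t≡r) = t≡r
      meet (there i)  (there j)  with prefix p i | prefix q j
      ... | p′ , p′⊆p | q′ , q′⊆q =
        no-detour e f a≢b p′ q′ (head∉ e p u ∘ p′⊆p) (head∉ f q v ∘ q′⊆q)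

    -- The Gromov product of `x` and `y` at `r`, taken as the length of a common prefix; `d-gromov`
    -- relates it to the usual formula in distances.
    gromov : V → V → V → ℚ
    gromov r x y = shared r (steps (proj₁ (connected r x))) (steps (proj₁ (connected r y)))

    d-gromov : ∀ r x y → d x y ℚ.+ (gromov r x y ℚ.+ gromov r x y) ≡ d r x ℚ.+ d r y
    d-gromov r x y = d-meet _ _ (proj₂ (connected r x)) (proj₂ (connected r y))

    d-sym : ∀ x y → d x y ≡ d y x
    d-sym x y = trans (d-fork p ε (proj₂ (connected y x)) ([] ∷ []) λ { _ (here t≡y) → t≡y })
                      (ℚ.+-identityʳ _)
      where p = proj₁ (connected y x)

    gromov-ultra : ∀ r x y z → gromov r x y ℚ.≤ gromov r x z ⊎ gromov r y z ℚ.≤ gromov r x z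
    gromov-ultra r x y z = shared-ultra r (walk x) (walk y) (walk z)
      where
      walk : V → List V
      walk v = steps (proj₁ (connected r v))

    -- Expressing `d x y` and `d x z` by Gromov products at `t` turns both sides into the sum of the
    -- three distances from `t`, less twice a Gromov product.
    gromov-≤⇒ : ∀ x y z t → gromov t x y ℚ.≤ gromov t x z →
                d x z ℚ.+ d y t ℚ.≤ d x y ℚ.+ d z t
    gromov-≤⇒ x y z t gxy≤gxz = +-cancelʳ-≤ (S ℚ.+ S) (begin
      (d x z ℚ.+ d y t) ℚ.+ (S ℚ.+ S)
        ≤⟨ ℚ.+-monoʳ-≤ (d x z ℚ.+ d y t) (ℚ.+-mono-≤ gxy≤gxz gxy≤gxz) ⟩
      (d x z ℚ.+ d y t) ℚ.+ (S′ ℚ.+ S′) ≡⟨ swap (d x z) (d y t) (S′ ℚ.+ S′) ⟩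
      (d x z ℚ.+ (S′ ℚ.+ S′)) ℚ.+ d y t ≡⟨ cong₂ ℚ._+_ (d-gromov t x z) (d-sym y t) ⟩
      (d t x ℚ.+ d t z) ℚ.+ d t y ≡⟨ swap (d t x) (d t z) (d t y) ⟩
      (d t x ℚ.+ d t y) ℚ.+ d t z ≡⟨ cong₂ ℚ._+_ (d-gromov t x y) (d-sym z t) ⟨
      (d x y ℚ.+ (S ℚ.+ S)) ℚ.+ d z t ≡⟨ swap (d x y) (S ℚ.+ S) (d z t) ⟩
      (d x y ℚ.+ d z t) ℚ.+ (S ℚ.+ S) ∎)
      where
      open ℚ.≤-Reasoning
      S  = gromov t x y
      S′ = gromov t x z
      swap : ∀ a b c → (a ℚ.+ b) ℚ.+ c ≡ (a ℚ.+ c) ℚ.+ b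
      swap = solve 3 (λ a b c → (a :+ b) :+ c := (a :+ c) :+ b) refl

    gromov-sym : ∀ r x y → gromov r x y ≡ gromov r y x
    gromov-sym r x y =
      shared-sym r (steps (proj₁ (connected r x))) (steps (proj₁ (connected r y)))

    four-point : ∀ x y z t → d x z ℚ.+ d y t ℚ.≤ d x y ℚ.+ d z t ⊎
                             d x z ℚ.+ d y t ℚ.≤ d y z ℚ.+ d x t
    four-point x y z t = Sum.map (gromov-≤⇒ x y z t)
      -- This alternative is the first one with `x` and `z` exchanged.
      (λ gyz≤gxz → subst₂ ℚ._≤_ (cong (ℚ._+ d y t) (d-sym z x)) (cong (ℚ._+ d x t) (d-sym z y))
        (gromov-≤⇒ z y x t
          (subst₂ ℚ._≤_ (gromov-sym t y z) (gromov-sym t x z) gyz≤gxz)))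
      (gromov-ultra t x y z)

-- Eventual inequalities up to arbitrarily small errors

infix 4 _≲_
record _≲_ (f g : ℕ → ℚ) : Set where
  constructor within
  field
    eventually : ∀ e → 0ℚ ℚ.< e → ∃ λ N → ∀ n → N ℕ.≤ n → f n ℚ.≤ g n ℚ.+ e

open _≲_

≤⇒≲ : ∀ {f g N} → (∀ n → N ℕ.≤ n → f n ℚ.≤ g n) → f ≲ g
≤⇒≲ {g = g} {N} f≤g = within λ e 0<e → N , λ n N≤n → ℚ.≤-trans (f≤g n N≤n)
  (subst (ℚ._≤ g n ℚ.+ e) (ℚ.+-identityʳ (g n)) (ℚ.+-monoʳ-≤ (g n) (ℚ.<⇒≤ 0<e)))

≲-refl : ∀ {f} → f ≲ f
≲-refl = ≤⇒≲ {N = 0} λ _ _ → ℚ.≤-refl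

≲-trans : ∀ {f g h} → f ≲ g → g ≲ h → f ≲ h
eventually (≲-trans {f} {g} {h} f≲g g≲h) e 0<e
  with eventually f≲g (½* e) (½*-pos 0<e) | eventually g≲h (½* e) (½*-pos 0<e)
... | M , p | N , q = M ⊔ N , λ n ≤n → begin
  f n                       ≤⟨ p n (ℕ.m⊔n≤o⇒m≤o M N ≤n) ⟩
  g n ℚ.+ ½* e              ≤⟨ ℚ.+-monoˡ-≤ (½* e) (q n (ℕ.m⊔n≤o⇒n≤o M N ≤n)) ⟩
  (h n ℚ.+ ½* e) ℚ.+ ½* e   ≡⟨ ℚ.+-assoc (h n) _ _ ⟩
  h n ℚ.+ (½* e ℚ.+ ½* e)   ≡⟨ cong (h n ℚ.+_) (½+½ e) ⟩
  h n ℚ.+ e ∎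
  where open ℚ.≤-Reasoning

≲-+ : ∀ {f f′ g g′} → f ≲ g → f′ ≲ g′ → (λ n → f n ℚ.+ f′ n) ≲ (λ n → g n ℚ.+ g′ n)
eventually (≲-+ {f} {f′} {g} {g′} p q) e 0<e
  with eventually p (½* e) (½*-pos 0<e) | eventually q (½* e) (½*-pos 0<e)
... | M , p | N , q = M ⊔ N , λ n ≤n → begin
  f n ℚ.+ f′ n
    ≤⟨ ℚ.+-mono-≤ (p n (ℕ.m⊔n≤o⇒m≤o M N ≤n)) (q n (ℕ.m⊔n≤o⇒n≤o M N ≤n)) ⟩
  (g n ℚ.+ ½* e) ℚ.+ (g′ n ℚ.+ ½* e)
    ≡⟨ solve 3 (λ a b c → (a :+ c) :+ (b :+ c) := (a :+ b) :+ (c :+ c)) refl (g n) (g′ n) (½* e) ⟩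
  (g n ℚ.+ g′ n) ℚ.+ (½* e ℚ.+ ½* e)   ≡⟨ cong ((g n ℚ.+ g′ n) ℚ.+_) (½+½ e) ⟩
  (g n ℚ.+ g′ n) ℚ.+ e ∎
  where open ℚ.≤-Reasoning

-- If y n + e < x n for a late index n, the Cauchy condition makes y < x
-- with a gap of half e.
≤ℝ⇒≲ : ∀ {x y} → x ≤ℝ y → seq x ≲ seq y
eventually (≤ℝ⇒≲ {x} {y} x≤y) e 0<e
  with cauchy x e₄ 0<e₄ | cauchy y e₄ 0<e₄
  where
  e₄ = ½* (½* e)
  0<e₄ = ½*-pos (½*-pos 0<e)
... | M , close-x | N , close-y = M ⊔ N , bound
  where
  e₂ = ½* e
  e₄ = ½* e₂
  bound : ∀ n → M ⊔ N ℕ.≤ n → seq x n ℚ.≤ seq y n ℚ.+ e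
  bound n ≤n with seq x n ℚ.≤? seq y n ℚ.+ e
  ... | yes p = p
  ... | no ¬p = ⊥-elim (x≤y (e₂ , ½*-pos 0<e , M ⊔ N , gap))
    where
    open ℚ.≤-Reasoning
    gap : ∀ m → M ⊔ N ℕ.≤ m → seq y m ℚ.+ e₂ ℚ.< seq x m
    gap m ≤m = ℚ.≰⇒> λ xm≤ → ¬p (begin
      seq x n
        ≤⟨ ∣-∣<⇒≤+ {seq x n} {seq x m}
             (close-x n m (ℕ.m⊔n≤o⇒m≤o M N ≤n) (ℕ.m⊔n≤o⇒m≤o M N ≤m)) ⟩
      seq x m ℚ.+ e₄
        ≤⟨ ℚ.+-monoˡ-≤ e₄ xm≤ ⟩
      (seq y m ℚ.+ e₂) ℚ.+ e₄
        ≤⟨ ℚ.+-monoˡ-≤ e₄ (ℚ.+-monoˡ-≤ e₂ (∣-∣<⇒≤+ {seq y m} {seq y n}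
             (close-y m n (ℕ.m⊔n≤o⇒n≤o M N ≤m) (ℕ.m⊔n≤o⇒n≤o M N ≤n)))) ⟩
      ((seq y n ℚ.+ e₄) ℚ.+ e₂) ℚ.+ e₄
        ≡⟨ solve 3 (λ a b c → ((a :+ c) :+ b) :+ c := a :+ (b :+ (c :+ c))) refl (seq y n) e₂ e₄ ⟩
      seq y n ℚ.+ (e₂ ℚ.+ (e₄ ℚ.+ e₄)) ≡⟨ cong (λ z → seq y n ℚ.+ (e₂ ℚ.+ z)) (½+½ e₂) ⟩
      seq y n ℚ.+ (e₂ ℚ.+ e₂) ≡⟨ cong (seq y n ℚ.+_) (½+½ e) ⟩
      seq y n ℚ.+ e ∎)

0<ℝ⇒pos : ∀ {x} → 0ℝ <ℝ x → ∃ λ N → ∀ n → N ℕ.≤ n → 0ℚ ℚ.< seq x n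
0<ℝ⇒pos (e , 0<e , N , e<x) = N , λ n N≤n →
  ℚ.<-trans 0<e (subst (ℚ._< _) (ℚ.+-identityˡ e) (e<x n N≤n))

-- Rational approximations of a weighted tree

module Approximation (T : WeightedTree) where
  open WeightedTree T
  open TreePaths graph isTree

  private
    index : V → Fin order
    index = Inverse.to finite

  -- weight is symmetric up to ≈ℝ only, so the terms of index n need not be
  -- symmetric.
  edgeWeight : V → V → ℝ
  edgeWeight x y with index x Fin.≤? index y
  ... | yes _ = weight x y
  ... | no  _ = weight y x

  edgeWeight-sym : ∀ x y → edgeWeight x y ≡ edgeWeight y x
  edgeWeight-sym x y with index x Fin.≤? index y | index y Fin.≤? index x
  ... | yes x≤y | yes y≤x with refl ← Injection.injective (↔⇒↣ finite) (Fin.≤-antisym x≤y y≤x) = refl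
  ... | yes _   | no _    = refl
  ... | no _    | yes _   = refl
  ... | no x≰y  | no y≰x  with Fin.≤-total (index x) (index y)
  ...   | inj₁ x≤y = ⊥-elim (x≰y x≤y)
  ...   | inj₂ y≤x = ⊥-elim (y≰x y≤x)

  -- Absolute values give nonnegative weights at every index and on all pairs, as `TreeMetric`
  -- requires. On an edge they eventually change nothing, its weight being positive.
  w : ℕ → V → V → ℚ
  w n x y = ℚ.∣ seq (edgeWeight x y) n ∣

  module At (n : ℕ) = TreeMetric (w n)
    (λ x y → cong (λ r → ℚ.∣ seq r n ∣) (edgeWeight-sym x y))
    (λ x y → ℚ.0≤∣p∣ (seq (edgeWeight x y) n))

  edgeWeight-pos : ∀ {x y} → x ~ y → 0ℝ <ℝ edgeWeight x y
  edgeWeight-pos {x} {y} e with index x Fin.≤? index y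
  ... | yes _ = weight-pos e
  ... | no  _ = weight-pos (~-sym e)

  edgeWeight≲ : ∀ {x y} → x ~ y → seq (edgeWeight x y) ≲ seq (weight x y)
  edgeWeight≲ {x} {y} e with index x Fin.≤? index y
  ... | yes _ = ≲-refl
  ... | no  _ = ≤ℝ⇒≲ {weight y x} {weight x y} (proj₂ (weight-sym e))

  ≲edgeWeight : ∀ {x y} → x ~ y → seq (weight x y) ≲ seq (edgeWeight x y)
  ≲edgeWeight {x} {y} e with index x Fin.≤? index y
  ... | yes _ = ≲-refl
  ... | no  _ = ≤ℝ⇒≲ {weight x y} {weight y x} (proj₁ (weight-sym e))

  w≲weight : ∀ {x y} → x ~ y → (λ n → w n x y) ≲ seq (weight x y)
  w≲weight {x} {y} e with 0<ℝ⇒pos {edgeWeight x y} (edgeWeight-pos e)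
  ... | N , pos = ≲-trans (≤⇒≲ {N = N} λ n N≤n → ℚ.≤-reflexive (ℚ.0≤p⇒∣p∣≡p (ℚ.<⇒≤ (pos n N≤n))))
                          (edgeWeight≲ e)

  weight≲w : ∀ {x y} → x ~ y → seq (weight x y) ≲ (λ n → w n x y)
  weight≲w {x} {y} e = ≲-trans (≲edgeWeight e)
    (≤⇒≲ {N = 0} λ n _ → p≤∣p∣ (seq (edgeWeight x y) n))

  length≲ : ∀ {x y} (p : Walk graph x y) →
            (λ n → At.length n (verts p)) ≲ seq (walkWeight p)
  length≲ ε = ≲-refl
  length≲ (e ◅ p) = ≲-trans (≤⇒≲ {N = 0} λ n _ → ℚ.≤-reflexive (At.length-◅ n e p))
    (≲-+ (w≲weight e) (length≲ p))

  ≲length : ∀ {x y} (p : Walk graph x y) →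
            seq (walkWeight p) ≲ (λ n → At.length n (verts p))
  ≲length ε = ≲-refl
  ≲length (e ◅ p) = ≲-trans (≲-+ (weight≲w e) (≲length p))
    (≤⇒≲ {N = 0} λ n _ → ℚ.≤-reflexive (sym (At.length-◅ n e p)))

-- From a PCG to a rational distance table

-- All that the colour argument uses of a PCG: one rational distance table on the vertices of `G`,
-- without the tree. Each non-edge carries a definite choice of colour.
record Realisation (G : Graph) : Set where
  open Graph G
  field
    d          : V → V → ℚ
    lo hi      : ℚ
    lo≤hi      : lo ℚ.≤ hi
    d-sym      : ∀ x y → d x y ≡ d y x
    four-point : ∀ x y z t → d x z ℚ.+ d y t ℚ.≤ d x y ℚ.+ d z t ⊎
                             d x z ℚ.+ d y t ℚ.≤ d y z ℚ.+ d x t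
    edge       : ∀ {x y} → x ~ y → lo ℚ.≤ d x y × d x y ℚ.≤ hi
    non-edge   : ∀ {x y} → x ≢ y → ¬ (x ~ y) → d x y ℚ.< lo ⊎ hi ℚ.< d x y

-- P holds for every small enough margin and, given the margin, from some
-- index on; the double negation lets finitely many undecidable case
-- distinctions be made on the way.
Ultimately : (ℚ → ℕ → Set) → Set
Ultimately P = ¬ ¬ ∃ λ e → 0ℚ ℚ.< e ×
  (∀ e′ → 0ℚ ℚ.< e′ → e′ ℚ.≤ e → ∃ λ N → ∀ n → N ℕ.≤ n → P e′ n)

ultimately-map : ∀ {P Q} → (∀ e n → P e n → Q e n) → Ultimately P → Ultimately Q
ultimately-map f ¬¬p ¬q = ¬¬p λ (e , 0<e , p) → ¬q (e , 0<e , λ e′ 0<e′ e′≤e →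
  proj₁ (p e′ 0<e′ e′≤e) , λ n N≤n → f e′ n (proj₂ (p e′ 0<e′ e′≤e) n N≤n))

ultimately-× : ∀ {P Q} → Ultimately P → Ultimately Q → Ultimately λ e n → P e n × Q e n
ultimately-× ¬¬p ¬¬q ¬pq = ¬¬p λ (e , 0<e , p) → ¬¬q λ (f , 0<f , q) →
  ¬pq (e ℚ.⊓ f , ⊓-pos 0<e 0<f , λ e′ 0<e′ e′≤ →
    let M , p′ = p e′ 0<e′ (ℚ.≤-trans e′≤ (ℚ.p⊓q≤p e f))
        N , q′ = q e′ 0<e′ (ℚ.≤-trans e′≤ (ℚ.p⊓q≤q e f))
    in M ⊔ N , λ n ≤n → p′ n (ℕ.m⊔n≤o⇒m≤o M N ≤n) , q′ n (ℕ.m⊔n≤o⇒n≤o M N ≤n))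
  where
  ⊓-pos : ∀ {e f} → 0ℚ ℚ.< e → 0ℚ ℚ.< f → 0ℚ ℚ.< e ℚ.⊓ f
  ⊓-pos {e} {f} 0<e 0<f with ℚ.⊓-sel e f
  ... | inj₁ ≡e = subst (0ℚ ℚ.<_) (sym ≡e) 0<e
  ... | inj₂ ≡f = subst (0ℚ ℚ.<_) (sym ≡f) 0<f

ultimately-always : ∀ {P : ℚ → ℕ → Set} → (∀ e n → P e n) → Ultimately P
ultimately-always p ¬p = ¬p (1ℚ , ℚ.positive⁻¹ 1ℚ , λ e′ _ _ → 0 , λ n _ → p e′ n)

ultimately-Fin : ∀ {k} {P : Fin k → ℚ → ℕ → Set} → (∀ i → Ultimately (P i)) →
                 Ultimately λ e n → ∀ i → P i e n
ultimately-Fin {ℕ.zero} p = ultimately-always λ _ _ ()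
ultimately-Fin {suc k}  p = ultimately-map
  (λ _ _ (p₀ , pₛ) → λ { zero → p₀ ; (suc i) → pₛ i })
  (ultimately-× (p zero) (ultimately-Fin (p ∘ suc)))

ultimately-≲ : ∀ {f g} → f ≲ g → Ultimately λ e n → f n ℚ.≤ g n ℚ.+ e
ultimately-≲ f≲g ¬p = ¬p (1ℚ , ℚ.positive⁻¹ 1ℚ , λ e 0<e _ → eventually f≲g e 0<e)

-- Half of the gap separating x from y absorbs the approximation errors on
-- both sides, the other half is left for the margin.
ultimately-< : ∀ {x y f g} → x <ℝ y → f ≲ seq x → seq y ≲ g →
               Ultimately λ e n → f n ℚ.+ e ℚ.< g n
ultimately-< {x} {y} {f} {g} (c , 0<c , K , x<y) f≲x y≲g ¬p =
  ¬p (c₂ , 0<c₂ , λ e _ e≤c₂ → K ⊔ (proj₁ M ⊔ proj₁ N) , λ n ≤n →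
    let ≤n′ = ℕ.m⊔n≤o⇒n≤o K _ ≤n in cancel n e e≤c₂
      (x<y n (ℕ.m⊔n≤o⇒m≤o K _ ≤n))
      (proj₂ M n (ℕ.m⊔n≤o⇒m≤o (proj₁ M) _ ≤n′))
      (proj₂ N n (ℕ.m⊔n≤o⇒n≤o (proj₁ M) _ ≤n′)))
  where
  c₂ = ½* c
  c₄ = ½* c₂
  0<c₂ = ½*-pos 0<c
  M = eventually f≲x c₄ (½*-pos 0<c₂)
  N = eventually y≲g c₄ (½*-pos 0<c₂)
  cancel : ∀ n e → e ℚ.≤ c₂ → seq x n ℚ.+ c ℚ.< seq y n →
           f n ℚ.≤ seq x n ℚ.+ c₄ → seq y n ℚ.≤ g n ℚ.+ c₄ → f n ℚ.+ e ℚ.< g n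
  cancel n e e≤c₂ x+c<y f≤ y≤ = ℚ.≰⇒> λ g≤ → ℚ.<-irrefl refl (ℚ.<-≤-trans x+c<y (begin
    seq y n                       ≤⟨ y≤ ⟩
    g n ℚ.+ c₄                    ≤⟨ ℚ.+-monoˡ-≤ c₄ g≤ ⟩
    (f n ℚ.+ e) ℚ.+ c₄            ≤⟨ ℚ.+-monoˡ-≤ c₄ (ℚ.+-mono-≤ f≤ e≤c₂) ⟩
    ((seq x n ℚ.+ c₄) ℚ.+ c₂) ℚ.+ c₄
      ≡⟨ solve 3 (λ a b c → ((a :+ c) :+ b) :+ c := a :+ (b :+ (c :+ c))) refl (seq x n) c₂ c₄ ⟩
    seq x n ℚ.+ (c₂ ℚ.+ (c₄ ℚ.+ c₄)) ≡⟨ cong (λ z → seq x n ℚ.+ (c₂ ℚ.+ z)) (½+½ c₂) ⟩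
    seq x n ℚ.+ (c₂ ℚ.+ c₂)       ≡⟨ cong (seq x n ℚ.+_) (½+½ c) ⟩
    seq x n ℚ.+ c ∎))
    where open ℚ.≤-Reasoning

≤+⇒-≤ : ∀ {p q e} → p ℚ.≤ q ℚ.+ e → p ℚ.- e ℚ.≤ q
≤+⇒-≤ {p} {q} {e} p≤ = begin
  p ℚ.- e           ≤⟨ ℚ.+-monoˡ-≤ (ℚ.- e) p≤ ⟩
  (q ℚ.+ e) ℚ.- e   ≡⟨ solve 2 (λ q e → (q :+ e) :- e := q) refl q e ⟩
  q ∎
  where open ℚ.≤-Reasoning

+<⇒<- : ∀ {p q e} → p ℚ.+ e ℚ.< q → p ℚ.< q ℚ.- e
+<⇒<- {p} {q} {e} <q = begin-strict
  p                 ≡⟨ solve 2 (λ q e → q := (q :+ e) :- e) refl p e ⟩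
  (p ℚ.+ e) ℚ.- e   <⟨ ℚ.+-monoˡ-< (ℚ.- e) <q ⟩
  q ℚ.- e ∎
  where open ℚ.≤-Reasoning

module _ {G : Graph} (pcg : IsPCG G) where
  open Graph G
  open IsPCG pcg
  open WeightedTree tree using (dist; connected)
  open Approximation tree

  private
    leaf : V → WeightedTree.V tree
    leaf v = proj₁ (ζ v)

    D : ℕ → V → V → ℚ
    D n u v = At.d n (leaf u) (leaf v)

    D≲dist : ∀ u v → (λ n → D n u v) ≲ seq (dist (leaf u) (leaf v))
    D≲dist u v = length≲ (proj₁ (connected (leaf u) (leaf v)))

    dist≲D : ∀ u v → seq (dist (leaf u) (leaf v)) ≲ (λ n → D n u v)
    dist≲D u v = ≲length (proj₁ (connected (leaf u) (leaf v)))

    -- The window from `dmin` to `dmax` is widened by `e` at both ends. Edges at its very boundary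
    -- survive approximation errors, and non-edges stay outside once `e` is small against their gap.
    Coloured : V → V → ℚ → ℕ → Set
    Coloured u v e n =
      (u ~ v → seq dmin n ℚ.- e ℚ.≤ D n u v × D n u v ℚ.≤ seq dmax n ℚ.+ e) ×
      (u ≢ v → ¬ (u ~ v) → D n u v ℚ.< seq dmin n ℚ.- e ⊎ seq dmax n ℚ.+ e ℚ.< D n u v)

    coloured : ∀ u v → Ultimately (Coloured u v)
    coloured u v with u ~? v
    ... | yes u~v = ultimately-map
      (λ e n (l , h) → (λ _ → ≤+⇒-≤ {seq dmin n} {D n u v} l , h) , λ _ u≁v → ⊥-elim (u≁v u~v))
      (ultimately-×
        (ultimately-≲ (≲-trans (≤ℝ⇒≲ {dmin} {dist (leaf u) (leaf v)} (proj₁ bounds)) (dist≲D u v)))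
        (ultimately-≲ (≲-trans (D≲dist u v) (≤ℝ⇒≲ {dist (leaf u) (leaf v)} {dmax} (proj₂ bounds)))))
      where
      u≢v : u ≢ v
      u≢v u≡v = ~-irrefl u≡v u~v
      bounds = Equivalence.to (adjacency u v u≢v) u~v
    -- A distance strictly on either side of the window would contradict `¬p`, so it lies inside and
    -- `adjacency` yields an edge. At `u ≡ v` the claim is vacuous, so `¬p` gives `u ≢ v` as well.
    ... | no u≁v = λ ¬p →
      let vacuous : ∀ e n → u ≡ v → Coloured u v e n
          vacuous e n u≡v = (λ u~v → ⊥-elim (u≁v u~v)) , λ u≢v → ⊥-elim (u≢v u≡v)
          u≢v : u ≢ v
          u≢v u≡v = ultimately-always (λ e n → vacuous e n u≡v) ¬p
          far : ∀ {e n} → D n u v ℚ.< seq dmin n ℚ.- e ⊎ seq dmax n ℚ.+ e ℚ.< D n u v →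
                Coloured u v e n
          far p = (λ u~v → ⊥-elim (u≁v u~v)) , λ _ _ → p
      in u≁v (Equivalence.from (adjacency u v u≢v)
        ( (λ dist<dmin → ultimately-map (λ e n → far ∘ inj₁ ∘ +<⇒<- {D n u v} {seq dmin n})
             (ultimately-< {dist (leaf u) (leaf v)} {dmin} dist<dmin (D≲dist u v) ≲-refl) ¬p)
        , (λ dmax<dist → ultimately-map (λ e n → far ∘ inj₂)
             (ultimately-< {dmax} {dist (leaf u) (leaf v)} dmax<dist ≲-refl (dist≲D u v)) ¬p)))

    all-coloured : Ultimately λ e n → ∀ u v → Coloured u v e n
    all-coloured = ultimately-map
      (λ e n c u v → subst₂ (λ u v → Coloured u v e n)
        (Inverse.strictlyInverseʳ finite u) (Inverse.strictlyInverseʳ finite v)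
        (c (Inverse.to finite u) (Inverse.to finite v)))
      (ultimately-Fin λ i → ultimately-Fin λ j →
        coloured (Inverse.from finite i) (Inverse.from finite j))

    ordered : Ultimately λ e n → seq dmin n ℚ.- e ℚ.≤ seq dmax n ℚ.+ e
    ordered ¬p = ¬p (1ℚ , ℚ.positive⁻¹ 1ℚ , λ e 0<e _ →
      let N , bound = eventually (≤ℝ⇒≲ {dmin} {dmax} dmin≤dmax) e 0<e
      in N , λ n N≤n → ℚ.≤-trans (≤+⇒-≤ {seq dmin n} (bound n N≤n))
        (subst (ℚ._≤ seq dmax n ℚ.+ e) (ℚ.+-identityʳ (seq dmax n))
          (ℚ.+-monoʳ-≤ (seq dmax n) (ℚ.<⇒≤ 0<e))))

  -- One margin and one index serve all pairs at once. The double negation comes from choosing a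
  -- side for each non-edge, and is harmless since the final goal is a negation.
  realise : ¬ ¬ Realisation G
  realise ¬r = ultimately-× all-coloured ordered λ (e , 0<e , p) →
    let N , q = p e 0<e ℚ.≤-refl
        coloured , lo≤hi = q N ℕ.≤-refl
    in ¬r record
      { d          = D N
      ; lo         = seq dmin N ℚ.- e
      ; hi         = seq dmax N ℚ.+ e
      ; lo≤hi      = lo≤hi
      ; d-sym      = λ x y → At.d-sym N (leaf x) (leaf y)
      ; four-point = λ x y z t → At.four-point N (leaf x) (leaf y) (leaf z) (leaf t)
      ; edge       = λ {x} {y} → proj₁ (coloured x y)
      ; non-edge   = λ {x} {y} → proj₂ (coloured x y)
      }

-- The hexagon inequality

module Realised {G : Graph} (R : Realisation G) where
  open Realisation R

  -- Adds three instances of the four-point condition and cancels the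
  -- diagonals k that they have in common.
  chain : ∀ k {a a′ b b′ c c′ p q} → a ℚ.≤ a′ → b ℚ.≤ b′ → c ℚ.≤ c′ →
          (a ℚ.+ b) ℚ.+ c ≡ p ℚ.+ k → (a′ ℚ.+ b′) ℚ.+ c′ ≡ q ℚ.+ k → p ℚ.≤ q
  chain k a≤ b≤ c≤ eq eq′ =
    +-cancelʳ-≤ k (subst₂ ℚ._≤_ eq eq′ (ℚ.+-mono-≤ (ℚ.+-mono-≤ a≤ b≤) c≤))

  -- Either two long diagonals are bounded by the two hexagon edges joining their ends, or all three
  -- by one of the two perfect matchings of the hexagon. Short diagonals on the right of one
  -- four-point instance return on the left of a later one, and so cancel.
  hexagon : ∀ u v w x y z →
    d u x ℚ.+ d v y ℚ.≤ d u v ℚ.+ d x y ⊎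
    d v y ℚ.+ d w z ℚ.≤ d v w ℚ.+ d y z ⊎
    d u x ℚ.+ d w z ℚ.≤ d u z ℚ.+ d w x ⊎
    (d u x ℚ.+ d v y) ℚ.+ d w z ℚ.≤ (d u v ℚ.+ d w x) ℚ.+ d y z ⊎
    (d u x ℚ.+ d v y) ℚ.+ d w z ℚ.≤ (d u z ℚ.+ d v w) ℚ.+ d x y
  hexagon u v w x y z with four-point u v x y
  ... | inj₁ ≤uv+xy = inj₁ ≤uv+xy
  ... | inj₂ ≤vx+uy with four-point u w y z
  ...   | inj₁ ≤uw+yz with four-point u v w x
  ...     | inj₁ ≤uv+wx = inj₂ (inj₂ (inj₂ (inj₁ (chain
    (d u w ℚ.+ d v x ℚ.+ d u y) ≤vx+uy ≤uw+yz ≤uv+wx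
    (solve 6 (λ ux vy uy wz uw vx →
        ((ux :+ vy) :+ (uy :+ wz)) :+ (uw :+ vx)
        := ((ux :+ vy) :+ wz) :+ ((uw :+ vx) :+ uy)) refl
      (d u x) (d v y) (d u y) (d w z) (d u w) (d v x))
    (solve 6 (λ vx uy uw yz uv wx →
        ((vx :+ uy) :+ (uw :+ yz)) :+ (uv :+ wx)
        := ((uv :+ wx) :+ yz) :+ ((uw :+ vx) :+ uy)) refl
      (d v x) (d u y) (d u w) (d y z) (d u v) (d w x))))))
  ...     | inj₂ ≤vw+ux = inj₂ (inj₁ (chain
    (d u x ℚ.+ d u w ℚ.+ d v x ℚ.+ d u y) ≤vx+uy ≤uw+yz ≤vw+ux
    (solve 6 (λ ux vy uy wz uw vx →
        ((ux :+ vy) :+ (uy :+ wz)) :+ (uw :+ vx)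
        := (vy :+ wz) :+ (((ux :+ uw) :+ vx) :+ uy)) refl
      (d u x) (d v y) (d u y) (d w z) (d u w) (d v x))
    (solve 6 (λ vx uy uw yz vw ux →
        ((vx :+ uy) :+ (uw :+ yz)) :+ (vw :+ ux)
        := (vw :+ yz) :+ (((ux :+ uw) :+ vx) :+ uy)) refl
      (d v x) (d u y) (d u w) (d y z) (d v w) (d u x))))
  hexagon u v w x y z | inj₂ ≤vx+uy | inj₂ ≤wy+uz with four-point v w x y
  ...     | inj₁ ≤vw+xy = inj₂ (inj₂ (inj₂ (inj₂ (chain
    (d v x ℚ.+ d w y ℚ.+ d u y) ≤vx+uy ≤wy+uz ≤vw+xy
    (solve 6 (λ ux vy uy wz vx wy →
        ((ux :+ vy) :+ (uy :+ wz)) :+ (vx :+ wy)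
        := ((ux :+ vy) :+ wz) :+ ((vx :+ wy) :+ uy)) refl
      (d u x) (d v y) (d u y) (d w z) (d v x) (d w y))
    (solve 6 (λ vx uy wy uz vw xy →
        ((vx :+ uy) :+ (wy :+ uz)) :+ (vw :+ xy)
        := ((uz :+ vw) :+ xy) :+ ((vx :+ wy) :+ uy)) refl
      (d v x) (d u y) (d w y) (d u z) (d v w) (d x y))))))
  ...     | inj₂ ≤wx+vy = inj₂ (inj₂ (inj₁ (chain
    (d v y ℚ.+ d v x ℚ.+ d w y ℚ.+ d u y) ≤vx+uy ≤wy+uz ≤wx+vy
    (solve 6 (λ ux vy uy wz vx wy →
        ((ux :+ vy) :+ (uy :+ wz)) :+ (vx :+ wy)
        := (ux :+ wz) :+ (((vy :+ vx) :+ wy) :+ uy)) refl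
      (d u x) (d v y) (d u y) (d w z) (d v x) (d w y))
    (solve 6 (λ vx uy wy uz wx vy →
        ((vx :+ uy) :+ (wy :+ uz)) :+ (wx :+ vy)
        := (uz :+ wx) :+ (((vy :+ vx) :+ wy) :+ uy)) refl
      (d v x) (d u y) (d w y) (d u z) (d w x) (d v y)))))

-- Thresholds and colour literals

-- The names of the two thresholds: `low` stands for `lo` and `high` for `hi`.
data Level : Set where
  low high : Level

_⊑_ : Level → Level → Bool
low  ⊑ _    = true
high ⊑ high = true
high ⊑ low  = false

data Bound : Set where
  below above : Level → Bound

record Fact : Set where
  constructor fact
  field
    bound : Bound
    i j   : ℕ

data Literal : Set where
  red blue : (i j : ℕ) → Literal

-- An edge level t may be matched with a chord level s when t ⊑ s: the edge is
-- then strictly shorter than the chord.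
matched₂ : Level → Level → Level → Level → Bool
matched₂ t t′ s s′ = t ⊑ s ∧ t′ ⊑ s′ ∨ t ⊑ s′ ∧ t′ ⊑ s

matched₃ : Level → Level → Level → Level → Level → Level → Bool
matched₃ t t′ t″ s s′ s″ =
  t ⊑ s ∧ matched₂ t′ t″ s′ s″ ∨ t ⊑ s′ ∧ matched₂ t′ t″ s s″ ∨ t ⊑ s″ ∧ matched₂ t′ t″ s s′

-- Each validity field contradicts one of the five alternatives of `hexagon`. For concrete levels
-- the fields compute to the unit type and are filled in silently.
record Hexagon : Set where
  constructor hexagonal
  field
    uv vw wx xy yz uz  ux vy wz : Level
    {valid₁} : T (matched₂ uv xy ux vy)
    {valid₂} : T (matched₂ vw yz vy wz)
    {valid₃} : T (matched₂ uz wx ux wz)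
    {valid₄} : T (matched₃ uv wx yz ux vy wz)
    {valid₅} : T (matched₃ uz vw xy ux vy wz)

module Bounds {lo hi : ℚ} (lo≤hi : lo ℚ.≤ hi) where

  -- The strict cases are the colours red and blue; the other two are the bounds that edges satisfy.
  Below Above : Level → ℚ → Set
  Below low  q = q ℚ.< lo
  Below high q = q ℚ.≤ hi
  Above low  q = lo ℚ.≤ q
  Above high q = hi ℚ.< q

  Within : Bound → ℚ → Set
  Within (below t) = Below t
  Within (above t) = Above t

  red⇒below : ∀ t {q} → Below low q → Below t q
  red⇒below low  q<lo = q<lo
  red⇒below high q<lo = ℚ.<⇒≤ (ℚ.<-≤-trans q<lo lo≤hi)

  blue⇒above : ∀ t {q} → Above high q → Above t q
  blue⇒above low  hi<q = ℚ.<⇒≤ (ℚ.≤-<-trans lo≤hi hi<q)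
  blue⇒above high hi<q = hi<q

  -- Every combination allowed by `t ⊑ s` has a strict bound on at least one side.
  below<above : ∀ {t s p q} → T (t ⊑ s) → Below t p → Above s q → p ℚ.< q
  below<above {low}  {s}    {q = q} _ p<lo q≥ = ℚ.<-≤-trans p<lo (atLeast s q≥)
    where
    atLeast : ∀ s → Above s q → lo ℚ.≤ q
    atLeast low  = id
    atLeast high = blue⇒above low
  below<above {high} {high} _ p≤hi hi<q = ℚ.≤-<-trans p≤hi hi<q

  matched₂⇒< : ∀ {t t′ s s′ p p′ q q′} → T (matched₂ t t′ s s′) →
               Below t p → Below t′ p′ → Above s q → Above s′ q′ → p ℚ.+ p′ ℚ.< q ℚ.+ q′
  matched₂⇒< {t} {t′} {s} {s′} {q = q} {q′} m p p′ a a′ with Equivalence.to (T-∨ {t ⊑ s ∧ t′ ⊑ s′}) m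
  ... | inj₁ m′ = let m₁ , m₂ = Equivalence.to T-∧ m′ in
                  ℚ.+-mono-< (below<above m₁ p a) (below<above m₂ p′ a′)
  ... | inj₂ m′ = let m₁ , m₂ = Equivalence.to T-∧ m′ in
                  subst (_ ℚ.<_) (ℚ.+-comm q′ q)
                    (ℚ.+-mono-< (below<above m₁ p a′) (below<above m₂ p′ a))

  matched₃⇒< : ∀ {t t′ t″ s s′ s″ p p′ p″ q q′ q″} → T (matched₃ t t′ t″ s s′ s″) →
               Below t p → Below t′ p′ → Below t″ p″ → Above s q → Above s′ q′ → Above s″ q″ →
               (p ℚ.+ p′) ℚ.+ p″ ℚ.< (q ℚ.+ q′) ℚ.+ q″
  matched₃⇒< {t} {t′} {t″} {s} {s′} {s″} {p} {p′} {p″} {q} {q′} {q″} m b b′ b″ a a′ a″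
    with Equivalence.to (T-∨ {t ⊑ s ∧ matched₂ t′ t″ s′ s″}) m
  ... | inj₁ m′ = let m₁ , m₂ = Equivalence.to T-∧ m′ in
    subst₂ ℚ._<_ (sym (ℚ.+-assoc p p′ p″)) (sym (ℚ.+-assoc q q′ q″))
      (ℚ.+-mono-< (below<above m₁ b a) (matched₂⇒< m₂ b′ b″ a′ a″))
  ... | inj₂ m′ with Equivalence.to (T-∨ {t ⊑ s′ ∧ matched₂ t′ t″ s s″}) m′
  ...   | inj₁ m″ = let m₁ , m₂ = Equivalence.to T-∧ m″ in
    subst₂ ℚ._<_ (sym (ℚ.+-assoc p p′ p″))
      (trans (sym (ℚ.+-assoc q′ q q″)) (cong (ℚ._+ q″) (ℚ.+-comm q′ q)))
      (ℚ.+-mono-< (below<above m₁ b a′) (matched₂⇒< m₂ b′ b″ a a″))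
  ...   | inj₂ m″ = let m₁ , m₂ = Equivalence.to T-∧ m″ in
    subst₂ ℚ._<_ (sym (ℚ.+-assoc p p′ p″)) (ℚ.+-comm q″ (q ℚ.+ q′))
      (ℚ.+-mono-< (below<above m₁ b a″) (matched₂⇒< m₂ b′ b″ a a′))

-- Vertex codes and literals of the grid

-- Clamping from 2 on makes `vertex` total; a code below 27 is read as three base-3 digits.
fin₃ : ℕ → Fin 3
fin₃ 0 = zero
fin₃ 1 = suc zero
fin₃ _ = suc (suc zero)

vertex : ℕ → GridVertex
vertex k = fin₃ (k ℕ./ 9) , fin₃ (k ℕ./ 3 ℕ.% 3) , fin₃ (k ℕ.% 3)

code : GridVertex → ℕ
code (a , b , c) = 9 ℕ.* toℕ a ℕ.+ (3 ℕ.* toℕ b ℕ.+ toℕ c)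

infix 4 _≟ᵛ_
_≟ᵛ_ : DecidableEquality GridVertex
_≟ᵛ_ = ≡-dec Fin._≟_ (≡-dec Fin._≟_ Fin._≟_)

vertex-code : ∀ v → vertex (code v) ≡ v
vertex-code (a , b , c) = toWitness
  {a? = Fin.all? λ a → Fin.all? λ b → Fin.all? λ c → vertex (code (a , b , c)) ≟ᵛ (a , b , c)} tt a b c

open Graph P₃□P₃□P₃ using (_~_; _~?_)

adjacent : ℕ → ℕ → Bool
adjacent i j = does (vertex i ~? vertex j)

-- The bounds that every edge satisfies.
free : Fact → Bool
free (fact (below low)  i j) = false
free (fact (below high) i j) = adjacent i j
free (fact (above low)  i j) = adjacent i j
free (fact (above high) i j) = false

-- Normalises the pair, so that the syntactic test `_==_` recognises it in either order.
ordered : (ℕ → ℕ → Literal) → ℕ → ℕ → Literal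
ordered l i j = if i ≤ᵇ j then l i j else l j i

-- On a non-edge, below low and below high are equivalent, and so are the two
-- above bounds.
colouring : Fact → Literal
colouring (fact (below _) i j) = ordered red i j
colouring (fact (above _) i j) = ordered blue i j

literals : List Fact → List Literal
literals = map colouring ∘ filterᵇ (not ∘ free)

hexagonFacts : Hexagon → (u v w x y z : ℕ) → List Fact
hexagonFacts h u v w x y z =
  fact (below uv) u v ∷ fact (below vw) v w ∷ fact (below wx) w x ∷
  fact (below xy) x y ∷ fact (below yz) y z ∷ fact (below uz) u z ∷
  fact (above ux) u x ∷ fact (above vy) v y ∷ fact (above wz) w z ∷ []
  where open Hexagon h

-- Automorphisms of the grid

-- Reflections and transpositions of coordinates generate all symmetries of the cube. Each is an
-- involution, so that injectivity and reflection of adjacency follow without an inverse map.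
data Generator : Set where
  flip₁ flip₂ flip₃ swap₁₂ swap₁₃ swap₂₃ : Generator

act : Generator → GridVertex → GridVertex
act flip₁  (a , b , c) = opposite a , b , c
act flip₂  (a , b , c) = a , opposite b , c
act flip₃  (a , b , c) = a , b , opposite c
act swap₁₂ (a , b , c) = b , a , c
act swap₁₃ (a , b , c) = c , b , a
act swap₂₃ (a , b , c) = a , c , b

act-involutive : ∀ g v → act g (act g v) ≡ v
act-involutive flip₁  (a , _ , _) = cong (_, _) (Fin.opposite-involutive a)
act-involutive flip₂  (_ , b , _) = cong (λ b → _ , b , _) (Fin.opposite-involutive b)
act-involutive flip₃  (_ , _ , c) = cong (λ c → _ , _ , c) (Fin.opposite-involutive c)
act-involutive swap₁₂ _ = refl
act-involutive swap₁₃ _ = refl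
act-involutive swap₂₃ _ = refl

differBy1-opposite : ∀ i j → DifferBy1 i j → DifferBy1 (opposite i) (opposite j)
differBy1-opposite = toWitness {a? = Fin.all? λ i → Fin.all? λ j →
  (∣ toℕ i - toℕ j ∣ ℕ.≟ 1) →-dec (∣ toℕ (opposite i) - toℕ (opposite j) ∣ ℕ.≟ 1)} tt

act-~ : ∀ g u v → u ~ v → act g u ~ act g v
act-~ flip₁ (a , b , c) (a′ , b′ , c′) (inj₁ (p , q , r))
  = inj₁ (differBy1-opposite a a′ p , q , r)
act-~ flip₁ _ _ (inj₂ (inj₁ (p , q , r))) = inj₂ (inj₁ (cong opposite p , q , r))
act-~ flip₁ _ _ (inj₂ (inj₂ (p , q , r))) = inj₂ (inj₂ (cong opposite p , q , r))
act-~ flip₂ _ _ (inj₁ (p , q , r)) = inj₁ (p , cong opposite q , r)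
act-~ flip₂ (a , b , c) (a′ , b′ , c′) (inj₂ (inj₁ (p , q , r)))
  = inj₂ (inj₁ (p , differBy1-opposite b b′ q , r))
act-~ flip₂ _ _ (inj₂ (inj₂ (p , q , r))) = inj₂ (inj₂ (p , cong opposite q , r))
act-~ flip₃ _ _ (inj₁ (p , q , r)) = inj₁ (p , q , cong opposite r)
act-~ flip₃ _ _ (inj₂ (inj₁ (p , q , r))) = inj₂ (inj₁ (p , q , cong opposite r))
act-~ flip₃ (a , b , c) (a′ , b′ , c′) (inj₂ (inj₂ (p , q , r)))
  = inj₂ (inj₂ (p , q , differBy1-opposite c c′ r))
act-~ swap₁₂ _ _ (inj₁ (p , q , r)) = inj₂ (inj₁ (q , p , r))
act-~ swap₁₂ _ _ (inj₂ (inj₁ (p , q , r))) = inj₁ (q , p , r)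
act-~ swap₁₂ _ _ (inj₂ (inj₂ (p , q , r))) = inj₂ (inj₂ (q , p , r))
act-~ swap₁₃ _ _ (inj₁ (p , q , r)) = inj₂ (inj₂ (r , q , p))
act-~ swap₁₃ _ _ (inj₂ (inj₁ (p , q , r))) = inj₂ (inj₁ (r , q , p))
act-~ swap₁₃ _ _ (inj₂ (inj₂ (p , q , r))) = inj₁ (r , q , p)
act-~ swap₂₃ _ _ (inj₁ (p , q , r)) = inj₁ (p , r , q)
act-~ swap₂₃ _ _ (inj₂ (inj₁ (p , q , r))) = inj₂ (inj₂ (p , r , q))
act-~ swap₂₃ _ _ (inj₂ (inj₂ (p , q , r))) = inj₂ (inj₁ (p , r , q))

move : List Generator → GridVertex → GridVertex
move []       v = v
move (g ∷ gs) v = act g (move gs v)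

moveLiteral : List Generator → Literal → Literal
moveLiteral gs (red i j)  = ordered red  (code (move gs (vertex i))) (code (move gs (vertex j)))
moveLiteral gs (blue i j) = ordered blue (code (move gs (vertex i))) (code (move gs (vertex j)))

-- The certificate checker

data Step : Set where
  by-hexagon : Hexagon → (u v w x y z : ℕ) → Step
  by-lemma   : ℕ → List Generator → Step

Nogood : Set
Nogood = List Literal

lookup : List Nogood → ℕ → Maybe Nogood
lookup []       _       = nothing
lookup (l ∷ ls) 0       = just l
lookup (l ∷ ls) (suc i) = lookup ls i

nogood : List Nogood → Step → Maybe Nogood
nogood ls (by-hexagon h u v w x y z) = just (literals (hexagonFacts h u v w x y z))
nogood ls (by-lemma i gs)            = Maybe.map (map (moveLiteral gs)) (lookup ls i)

_==_ : Literal → Literal → Bool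
red i j  == red i′ j′  = (i ≡ᵇ i′) ∧ (j ≡ᵇ j′)
blue i j == blue i′ j′ = (i ≡ᵇ i′) ∧ (j ≡ᵇ j′)
_        == _          = false

_∈ᵇ_ : Literal → List Literal → Bool
l ∈ᵇ []       = false
l ∈ᵇ (m ∷ ms) = (l == m) ∨ (l ∈ᵇ ms)

unassumed : List Literal → Nogood → List Literal
unassumed as = filterᵇ (λ l → not (l ∈ᵇ as))

negate : Literal → Literal
negate (red i j)  = blue i j
negate (blue i j) = red i j

-- These are the pairs that `non-edge` speaks of. Only on them does the failure of one colour imply
-- the other.
two-coloured : ℕ → ℕ → Bool
two-coloured i j = not (adjacent i j) ∧ not (does (vertex i ≟ᵛ vertex j))

negatable : Literal → Bool
negatable (red i j)  = two-coloured i j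
negatable (blue i j) = two-coloured i j

-- Unit propagation: every step either contradicts the assumptions or leaves a
-- single literal, whose negation is assumed from then on.
refute : List Nogood → List Literal → List Step → Bool
refute ls as []       = false
refute ls as (s ∷ ss) with Maybe.map (unassumed as) (nogood ls s)
... | just []       = true
... | just (l ∷ []) = negatable l ∧ refute ls (negate l ∷ as) ss
... | _             = false

-- The indices in by-lemma count the nogoods from the first one on, and the last
-- nogood is empty.
verify : List Nogood → List (Nogood × List Step) → Bool
verify ls []                    = false
verify ls (([] , ss) ∷ _)       = refute ls [] ss
verify ls ((l@(_ ∷ _) , ss) ∷ c) = refute ls l ss ∧ verify (ls ++ l ∷ []) c

does⇒ : ∀ {A : Set} (a? : Dec A) → T (does a?) → A
does⇒ (yes a) _ = a

does⇒¬ : ∀ {A : Set} (a? : Dec A) → T (not (does a?)) → ¬ A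
does⇒¬ (no ¬a) _ = ¬a

-- Soundness of the checker

module Colours (R : Realisation P₃□P₃□P₃) where
  open Realisation R
  open Realised R using (hexagon)
  open Bounds lo≤hi

  Satisfied : Fact → Set
  Satisfied (fact b i j) = Within b (d (vertex i) (vertex j))

  Holds : Literal → Set
  Holds (red i j)  = Below low  (d (vertex i) (vertex j))
  Holds (blue i j) = Above high (d (vertex i) (vertex j))

  ordered-red : ∀ i j → Holds (ordered red i j) → Holds (red i j)
  ordered-red i j h with i ≤ᵇ j
  ... | true  = h
  ... | false = subst (Below low) (d-sym (vertex j) (vertex i)) h

  ordered-blue : ∀ i j → Holds (ordered blue i j) → Holds (blue i j)
  ordered-blue i j h with i ≤ᵇ j
  ... | true  = h
  ... | false = subst (Above high) (d-sym (vertex j) (vertex i)) h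

  adjacent⇒~ : ∀ i j → T (adjacent i j) → vertex i ~ vertex j
  adjacent⇒~ i j = does⇒ (vertex i ~? vertex j)

  free⇒satisfied : ∀ f → T (free f) → Satisfied f
  free⇒satisfied (fact (below high) i j) t = proj₂ (edge (adjacent⇒~ i j t))
  free⇒satisfied (fact (above low)  i j) t = proj₁ (edge (adjacent⇒~ i j t))

  colouring⇒satisfied : ∀ f → Holds (colouring f) → Satisfied f
  colouring⇒satisfied (fact (below t) i j) h = red⇒below t (ordered-red i j h)
  colouring⇒satisfied (fact (above s) i j) h = blue⇒above s (ordered-blue i j h)

  literals⇒satisfied : ∀ fs → All Holds (literals fs) → All Satisfied fs
  literals⇒satisfied []       _ = []
  literals⇒satisfied (f ∷ fs) hs with free f in eq
  ... | true  = free⇒satisfied f (subst T (sym eq) tt) ∷ literals⇒satisfied fs hs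
  ... | false with h ∷ hs ← hs = colouring⇒satisfied f h ∷ literals⇒satisfied fs hs

  hexagon-refuted : ∀ h u v w x y z → ¬ All Satisfied (hexagonFacts h u v w x y z)
  hexagon-refuted (hexagonal _ _ _ _ _ _ _ _ _ {m₁} {m₂} {m₃} {m₄} {m₅}) u v w x y z
    (uv ∷ vw ∷ wx ∷ xy ∷ yz ∷ uz ∷ ux ∷ vy ∷ wz ∷ [])
    with hexagon (vertex u) (vertex v) (vertex w) (vertex x) (vertex y) (vertex z)
  ... | inj₁ ≤ = ℚ.<-irrefl refl (ℚ.<-≤-trans (matched₂⇒< m₁ uv xy ux vy) ≤)
  ... | inj₂ (inj₁ ≤) = ℚ.<-irrefl refl (ℚ.<-≤-trans (matched₂⇒< m₂ vw yz vy wz) ≤)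
  ... | inj₂ (inj₂ (inj₁ ≤)) = ℚ.<-irrefl refl (ℚ.<-≤-trans (matched₂⇒< m₃ uz wx ux wz) ≤)
  ... | inj₂ (inj₂ (inj₂ (inj₁ ≤))) = ℚ.<-irrefl refl
    (ℚ.<-≤-trans (matched₃⇒< m₄ uv wx yz ux vy wz) ≤)
  ... | inj₂ (inj₂ (inj₂ (inj₂ ≤))) = ℚ.<-irrefl refl
    (ℚ.<-≤-trans (matched₃⇒< m₅ uz vw xy ux vy wz) ≤)

  two-coloured⇒ : ∀ i j → T (two-coloured i j) → Holds (red i j) ⊎ Holds (blue i j)
  two-coloured⇒ i j t = let t₁ , t₂ = Equivalence.to (T-∧ {not (adjacent i j)}) t in
    non-edge (does⇒¬ (vertex i ≟ᵛ vertex j) t₂) (does⇒¬ (vertex i ~? vertex j) t₁)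

  negate-holds : ∀ l → T (negatable l) → ¬ Holds l → Holds (negate l)
  negate-holds (red i j)  t ¬h = Sum.fromInj₂ (⊥-elim ∘ ¬h) (two-coloured⇒ i j t)
  negate-holds (blue i j) t ¬h = Sum.fromInj₁ (⊥-elim ∘ ¬h) (two-coloured⇒ i j t)

  ==⇒≡ : ∀ l m → T (l == m) → l ≡ m
  ==⇒≡ (red i j) (red i′ j′) t = let p , q = Equivalence.to T-∧ t in
    cong₂ red (ℕ.≡ᵇ⇒≡ i i′ p) (ℕ.≡ᵇ⇒≡ j j′ q)
  ==⇒≡ (blue i j) (blue i′ j′) t = let p , q = Equivalence.to T-∧ t in
    cong₂ blue (ℕ.≡ᵇ⇒≡ i i′ p) (ℕ.≡ᵇ⇒≡ j j′ q)

  ∈ᵇ-holds : ∀ l {as} → All Holds as → T (l ∈ᵇ as) → Holds l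
  ∈ᵇ-holds l {m ∷ ms} (h ∷ hs) t with Equivalence.to (T-∨ {l == m}) t
  ... | inj₁ l==m = subst Holds (sym (==⇒≡ l m l==m)) h
  ... | inj₂ l∈ms = ∈ᵇ-holds l hs l∈ms

  unassumed-holds : ∀ {as} → All Holds as → ∀ ls → All Holds (unassumed as ls) → All Holds ls
  unassumed-holds hs []       _ = []
  unassumed-holds {as} hs (l ∷ ls) us with l ∈ᵇ as in eq
  ... | true  = ∈ᵇ-holds l hs (subst T (sym eq) tt) ∷ unassumed-holds hs ls us
  ... | false with u ∷ us ← us = u ∷ unassumed-holds hs ls us

open Colours using (Holds)

-- Quantified over all realisations, so that an earlier pattern can be applied to a realisation
-- moved by an automorphism.
Refuted : Nogood → Set
Refuted l = ∀ R → ¬ All (Holds R) l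

move-~ : ∀ gs u v → u ~ v → move gs u ~ move gs v
move-~ []       u v u~v = u~v
move-~ (g ∷ gs) u v u~v = act-~ g _ _ (move-~ gs u v u~v)

move-~⁻¹ : ∀ gs u v → move gs u ~ move gs v → u ~ v
move-~⁻¹ []       u v p = p
move-~⁻¹ (g ∷ gs) u v p = move-~⁻¹ gs u v
  (subst₂ _~_ (act-involutive g _) (act-involutive g _) (act-~ g _ _ p))

move-injective : ∀ gs {u v} → move gs u ≡ move gs v → u ≡ v
move-injective []       eq = eq
move-injective (g ∷ gs) eq = move-injective gs
  (trans (sym (act-involutive g _)) (trans (cong (act g) eq) (act-involutive g _)))

-- The distance table is pulled back along an automorphism, which preserves and reflects both
-- adjacency and equality.
transport : List Generator → Realisation P₃□P₃□P₃ → Realisation P₃□P₃□P₃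
transport gs R = record
  { d          = λ u v → d (move gs u) (move gs v)
  ; lo         = lo
  ; hi         = hi
  ; lo≤hi      = lo≤hi
  ; d-sym      = λ u v → d-sym (move gs u) (move gs v)
  ; four-point = λ u v w x → four-point (move gs u) (move gs v) (move gs w) (move gs x)
  ; edge       = λ {u} {v} u~v → edge (move-~ gs u v u~v)
  ; non-edge   = λ {u} {v} u≢v u≁v → non-edge (u≢v ∘ move-injective gs) (u≁v ∘ move-~⁻¹ gs u v)
  }
  where open Realisation R

module _ (R : Realisation P₃□P₃□P₃) where
  open Colours R hiding (Holds)
  open Realisation R

  moveLiteral-holds : ∀ gs l → Holds R (moveLiteral gs l) → Holds (transport gs R) l
  moveLiteral-holds gs (red i j)  h =
    subst₂ (λ u v → d u v ℚ.< lo) (vertex-code _) (vertex-code _)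
      (ordered-red (code (move gs (vertex i))) (code (move gs (vertex j))) h)
  moveLiteral-holds gs (blue i j) h =
    subst₂ (λ u v → hi ℚ.< d u v) (vertex-code _) (vertex-code _)
      (ordered-blue (code (move gs (vertex i))) (code (move gs (vertex j))) h)

  moveLiterals-hold : ∀ gs ls → All (Holds R) (map (moveLiteral gs) ls) →
                      All (Holds (transport gs R)) ls
  moveLiterals-hold gs ls hs = All.map (λ {l} → moveLiteral-holds gs l) (All.map⁻ hs)

lookup-refuted : ∀ {ls} → All Refuted ls → ∀ i {l} → lookup ls i ≡ just l → Refuted l
lookup-refuted (r ∷ rs) 0       refl = r
lookup-refuted (r ∷ rs) (suc i) eq   = lookup-refuted rs i eq

nogood-refuted : ∀ {ls} → All Refuted ls → ∀ s {l} → nogood ls s ≡ just l → Refuted l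
nogood-refuted rs (by-hexagon h u v w x y z) refl R hs =
  hexagon-refuted h u v w x y z (literals⇒satisfied _ hs)
  where open Colours R hiding (Holds)
nogood-refuted {ls} rs (by-lemma i gs) eq R hs with lookup ls i in eq′
nogood-refuted rs (by-lemma i gs) refl R hs | just l =
  lookup-refuted rs i eq′ (transport gs R) (moveLiterals-hold R gs l hs)

refute-sound : ∀ {ls} → All Refuted ls → ∀ as ss → T (refute ls as ss) → Refuted as
refute-sound {ls} rs as (s ∷ ss) t R hs with nogood ls s in eq
... | just l with unassumed as l in eq′
...   | [] = nogood-refuted rs s eq R (unassumed-holds hs l (subst (All (Holds R)) (sym eq′) []))
  where open Colours R using (unassumed-holds)
...   | m ∷ [] =
  let t₁ , t₂ = Equivalence.to T-∧ t
      ¬m : ¬ Holds R m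
      ¬m h = nogood-refuted rs s eq R (unassumed-holds hs l (subst (All (Holds R)) (sym eq′) (h ∷ [])))
  in refute-sound rs (negate m ∷ as) ss t₂ R (negate-holds m t₁ ¬m ∷ hs)
  where open Colours R using (unassumed-holds; negate-holds)

verify-sound : ∀ {ls} → All Refuted ls → ∀ c → T (verify ls c) → ¬ Realisation P₃□P₃□P₃
-- The empty pattern holds in every realisation, so refuting it refutes `R`.
verify-sound rs (([] , ss) ∷ _) t R = refute-sound rs [] ss t R []
verify-sound rs ((l@(_ ∷ _) , ss) ∷ c) t = let t₁ , t₂ = Equivalence.to T-∧ t in
  verify-sound (All.++⁺ rs (refute-sound rs l ss t₁ ∷ [])) c t₂

-- The weakest valid choices of levels, up to the symmetries of the hexagon.

⬡₁ : (u v w x y z : ℕ) → Step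
⬡₁ = by-hexagon (hexagonal high high high low low high high low high)

⬡₂ : (u v w x y z : ℕ) → Step
⬡₂ = by-hexagon (hexagonal high low low low high high high low high)

⬡₃ : (u v w x y z : ℕ) → Step
⬡₃ = by-hexagon (hexagonal low low low high high low low high low)

⬡₄ : (u v w x y z : ℕ) → Step
⬡₄ = by-hexagon (hexagonal low low low low low low low low low)

⬡₅ : (u v w x y z : ℕ) → Step
⬡₅ = by-hexagon (hexagonal high high high high high high high high high)

-- The certificate

-- Codes such as 1, 3, 7 and 15 are midpoints of edges of the cube, 4, 10, 12, 14 and 16 are centres
-- of faces, and 13 is the centre. The last patterns colour only pairs of an edge midpoint and a
-- face centre.
certificate : List (Nogood × List Step)
certificate =
  (blue 3 10 ∷ red 3 14 ∷ red 7 10 ∷ red 7 12 ∷ red 10 15 ∷ red 14 15 ∷ [] ,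
    ⬡₁ 4 13 10 15 14 3 ∷ ⬡₃ 7 10 15 4 3 12 ∷ []) ∷
  (red 3 14 ∷ blue 6 13 ∷ blue 7 14 ∷ red 14 15 ∷ [] ,
    ⬡₅ 3 6 7 16 13 14 ∷ ⬡₅ 4 7 6 15 14 13 ∷ ⬡₃ 3 14 15 4 7 16 ∷ []) ∷
  (red 0 15 ∷ red 1 14 ∷ red 2 7 ∷ red 3 14 ∷ blue 3 16 ∷ blue 4 9 ∷ red 7 10 ∷ red 9 14 ∷
   blue 10 17 ∷ red 14 15 ∷ [] ,
    ⬡₁ 4 13 16 15 14 3 ∷ ⬡₁ 4 13 10 9 14 3 ∷ ⬡₁ 9 12 13 4 15 0 ∷ ⬡₂ 16 7 10 3 8 17 ∷
    ⬡₂ 8 5 10 3 14 17 ∷ ⬡₁ 3 4 5 2 7 10 ∷ ⬡₁ 5 4 13 10 3 2 ∷ ⬡₃ 3 2 13 0 9 10 ∷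
    ⬡₃ 2 9 14 1 4 13 ∷ []) ∷
  (red 1 12 ∷ red 1 14 ∷ blue 3 16 ∷ red 4 9 ∷ red 9 14 ∷ blue 10 15 ∷ red 14 15 ∷ [] ,
    ⬡₃ 1 14 9 4 3 12 ∷ ⬡₁ 4 13 16 15 14 3 ∷ ⬡₁ 10 13 16 15 4 9 ∷ ⬡₁ 10 13 16 15 14 1 ∷
    by-lemma 0 (flip₂ ∷ []) ∷ []) ∷
  (red 1 12 ∷ red 1 14 ∷ red 3 10 ∷ red 3 14 ∷ blue 3 16 ∷ red 10 17 ∷ [] ,
    ⬡₄ 1 12 17 10 3 14 ∷ ⬡₁ 12 13 16 17 10 3 ∷ []) ∷
  (red 1 16 ∷ blue 3 10 ∷ red 3 14 ∷ red 3 16 ∷ red 4 9 ∷ red 7 10 ∷ red 7 12 ∷ red 9 16 ∷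
   blue 11 16 ∷ [] ,
    ⬡₂ 10 1 16 3 2 11 ∷ ⬡₂ 2 5 16 3 14 11 ∷ ⬡₂ 2 1 16 9 4 5 ∷ ⬡₃ 7 2 9 4 3 12 ∷
    ⬡₁ 7 10 11 2 9 16 ∷ []) ∷
  (red 1 12 ∷ red 1 14 ∷ blue 3 10 ∷ red 3 14 ∷ red 7 10 ∷ red 7 12 ∷ red 9 14 ∷ red 14 15 ∷
   [] ,
    ⬡₁ 4 13 10 9 14 3 ∷ by-lemma 0 [] ∷ ⬡₁ 10 13 16 15 14 1 ∷ ⬡₁ 10 13 16 15 14 9 ∷
    by-lemma 3 [] ∷ by-lemma 5 [] ∷ ⬡₁ 4 7 10 11 16 3 ∷ ⬡₁ 10 13 12 3 16 11 ∷
    ⬡₄ 1 12 11 4 9 14 ∷ []) ∷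
  (red 1 12 ∷ red 1 14 ∷ blue 3 10 ∷ red 3 14 ∷ red 7 10 ∷ red 7 12 ∷ red 14 15 ∷ [] ,
    by-lemma 6 [] ∷ by-lemma 0 [] ∷ ⬡₁ 9 10 11 14 1 12 ∷ ⬡₃ 1 14 15 0 9 12 ∷
    ⬡₅ 0 3 14 11 10 9 ∷ ⬡₅ 0 3 14 13 10 9 ∷ ⬡₁ 10 13 16 15 14 1 ∷ ⬡₃ 0 11 12 1 4 13 ∷
    ⬡₂ 15 12 11 0 13 16 ∷ ⬡₁ 0 13 16 15 14 3 ∷ ⬡₁ 6 7 10 1 16 3 ∷ ⬡₁ 6 7 10 11 16 3 ∷
    ⬡₁ 10 13 14 3 16 9 ∷ ⬡₃ 1 6 11 4 13 14 ∷ ⬡₄ 0 7 12 1 6 13 ∷ ⬡₁ 7 10 9 0 11 16 ∷ []) ∷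
  (blue 0 15 ∷ blue 1 8 ∷ red 3 10 ∷ red 3 16 ∷ red 4 15 ∷ red 7 10 ∷ red 10 15 ∷
   blue 10 17 ∷ red 14 15 ∷ [] ,
    ⬡₂ 8 7 10 3 16 17 ∷ ⬡₁ 1 4 5 8 3 10 ∷ ⬡₂ 0 3 8 15 4 1 ∷ ⬡₂ 8 5 10 15 14 17 ∷ []) ∷
  (red 0 7 ∷ blue 0 15 ∷ red 1 14 ∷ blue 1 16 ∷ red 3 8 ∷ red 3 14 ∷ red 3 16 ∷ blue 8 15 ∷
   red 14 15 ∷ blue 14 25 ∷ [] ,
    ⬡₁ 4 13 16 15 14 1 ∷ ⬡₂ 16 15 14 1 24 25 ∷ ⬡₂ 24 15 14 3 16 25 ∷ ⬡₁ 1 4 15 24 7 0 ∷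
    ⬡₁ 7 4 15 24 3 8 ∷ []) ∷
  (blue 0 15 ∷ red 1 12 ∷ red 1 14 ∷ red 3 14 ∷ red 3 16 ∷ red 7 10 ∷ red 7 12 ∷ red 14 15 ∷
   [] ,
    by-lemma 7 [] ∷ ⬡₃ 10 7 12 1 0 3 ∷ ⬡₄ 1 12 7 10 3 16 ∷ ⬡₁ 1 12 15 16 3 10 ∷
    ⬡₃ 12 1 14 15 16 17 ∷ ⬡₃ 1 14 3 10 9 12 ∷ by-lemma 0 (swap₂₃ ∷ flip₃ ∷ flip₂ ∷ []) ∷
    ⬡₁ 4 13 16 15 14 1 ∷ ⬡₂ 16 7 12 1 8 17 ∷ ⬡₃ 4 15 10 3 0 9 ∷ by-lemma 8 [] ∷
    ⬡₁ 2 5 8 7 14 1 ∷ ⬡₂ 8 5 12 1 14 17 ∷ ⬡₁ 3 4 5 2 7 12 ∷ ⬡₁ 5 4 13 12 7 2 ∷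
    ⬡₁ 5 4 15 12 7 2 ∷ ⬡₃ 2 9 14 1 4 13 ∷ ⬡₂ 9 10 17 2 13 12 ∷ ⬡₁ 1 10 17 8 13 2 ∷
    ⬡₁ 5 8 17 10 7 2 ∷ ⬡₂ 8 7 2 3 16 17 ∷ ⬡₁ 5 4 13 16 3 8 ∷ ⬡₁ 13 16 17 8 15 2 ∷
    by-lemma 9 (swap₂₃ ∷ flip₃ ∷ flip₂ ∷ []) ∷ ⬡₁ 12 9 14 17 10 21 ∷ ⬡₁ 12 13 16 17 10 21 ∷
    ⬡₁ 4 1 12 21 10 5 ∷ ⬡₃ 14 21 16 5 8 7 ∷ ⬡₁ 1 12 15 16 21 0 ∷ ⬡₂ 0 3 8 21 4 1 ∷ []) ∷
  (red 1 12 ∷ blue 4 11 ∷ red 4 15 ∷ red 4 17 ∷ blue 5 10 ∷ red 7 10 ∷ red 7 14 ∷ blue 7 26 ∷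
   red 8 13 ∷ red 10 15 ∷ blue 10 17 ∷ red 14 15 ∷ [] ,
    ⬡₁ 5 2 11 10 15 4 ∷ ⬡₅ 1 4 5 14 11 10 ∷ ⬡₅ 2 5 4 7 10 11 ∷ ⬡₅ 2 5 4 13 10 11 ∷
    ⬡₃ 4 15 14 7 8 17 ∷ ⬡₄ 1 12 17 4 15 14 ∷ ⬡₁ 7 16 17 26 15 10 ∷ ⬡₂ 17 14 7 10 23 26 ∷
    ⬡₄ 1 8 13 2 7 14 ∷ ⬡₃ 7 2 13 8 17 14 ∷ ⬡₁ 1 16 17 8 15 10 ∷ ⬡₁ 15 16 17 26 1 12 ∷
    ⬡₂ 23 14 15 2 17 26 ∷ ⬡₂ 23 14 15 4 17 26 ∷ ⬡₁ 10 11 20 23 2 7 ∷ ⬡₁ 10 11 20 23 2 13 ∷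
    ⬡₁ 10 11 20 23 2 15 ∷ ⬡₁ 10 13 22 23 4 15 ∷ ⬡₅ 1 4 23 20 11 10 ∷ ⬡₃ 7 20 13 8 17 14 ∷
    ⬡₁ 22 23 26 17 20 15 ∷ ⬡₃ 14 15 22 17 26 25 ∷ ⬡₁ 10 19 22 17 20 1 ∷ ⬡₂ 16 13 20 1 22 25 ∷
    ⬡₁ 14 23 26 25 20 1 ∷ []) ∷
  (red 2 3 ∷ red 2 17 ∷ blue 3 8 ∷ red 7 12 ∷ red 7 14 ∷ red 7 26 ∷ red 8 13 ∷ blue 12 17 ∷
   [] ,
    ⬡₁ 4 5 8 17 2 3 ∷ ⬡₁ 13 8 17 26 7 12 ∷ ⬡₁ 3 4 17 26 7 12 ∷ ⬡₃ 7 26 13 8 5 14 ∷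
    ⬡₃ 2 3 26 5 8 17 ∷ []) ∷
  (blue 0 15 ∷ red 1 12 ∷ red 1 14 ∷ red 3 14 ∷ red 7 10 ∷ red 7 12 ∷ red 14 15 ∷ [] ,
    by-lemma 10 [] ∷ by-lemma 7 [] ∷ ⬡₃ 1 14 3 10 9 12 ∷ ⬡₁ 14 13 16 7 10 3 ∷
    ⬡₁ 4 13 16 15 14 3 ∷ by-lemma 6 (flip₂ ∷ []) ∷ ⬡₁ 10 13 16 15 14 3 ∷ by-lemma 4 [] ∷
    ⬡₃ 12 1 14 15 16 17 ∷ ⬡₂ 16 7 10 3 8 17 ∷ ⬡₂ 16 7 12 1 8 17 ∷ ⬡₂ 8 5 10 3 14 17 ∷
    ⬡₁ 2 5 8 7 14 1 ∷ ⬡₁ 5 4 13 10 7 2 ∷ ⬡₂ 5 4 15 10 7 8 ∷ ⬡₁ 1 2 5 8 15 10 ∷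
    ⬡₃ 7 2 15 4 3 12 ∷ ⬡₁ 13 16 17 8 15 10 ∷ ⬡₂ 16 13 2 3 14 17 ∷ ⬡₁ 4 5 8 17 2 3 ∷
    by-lemma 12 [] ∷ ⬡₃ 2 17 4 11 10 13 ∷ by-lemma 11 [] ∷ []) ∷
  (red 1 12 ∷ red 1 14 ∷ red 3 10 ∷ red 3 14 ∷ blue 3 16 ∷ red 7 10 ∷ red 7 12 ∷ red 14 15 ∷
   [] ,
    by-lemma 13 [] ∷ ⬡₃ 1 14 3 10 9 12 ∷ ⬡₁ 10 13 16 15 14 3 ∷ ⬡₃ 10 7 12 1 0 3 ∷
    by-lemma 4 [] ∷ ⬡₁ 14 13 16 7 10 3 ∷ ⬡₁ 4 13 16 15 14 3 ∷ by-lemma 6 (flip₂ ∷ []) ∷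
    ⬡₃ 7 0 15 4 13 12 ∷ ⬡₁ 10 13 16 17 12 1 ∷ ⬡₂ 16 7 10 3 8 17 ∷ ⬡₂ 16 7 12 1 8 17 ∷
    ⬡₂ 8 5 10 3 14 17 ∷ ⬡₁ 2 5 8 7 14 1 ∷ ⬡₁ 5 4 13 10 7 2 ∷ ⬡₂ 5 4 15 10 7 8 ∷
    ⬡₁ 1 2 5 8 15 10 ∷ ⬡₃ 7 2 15 4 3 12 ∷ by-lemma 2 [] ∷ ⬡₁ 13 16 17 8 15 10 ∷
    ⬡₂ 16 13 2 3 14 17 ∷ ⬡₁ 4 5 8 17 2 3 ∷ ⬡₃ 9 8 13 0 1 4 ∷ ⬡₁ 8 7 10 9 4 17 ∷ []) ∷
  (red 1 12 ∷ red 1 14 ∷ red 3 10 ∷ red 3 14 ∷ red 7 10 ∷ red 7 12 ∷ red 14 15 ∷ [] ,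
    by-lemma 13 [] ∷ ⬡₃ 1 14 3 10 9 12 ∷ by-lemma 14 [] ∷ ⬡₃ 10 7 12 1 0 3 ∷
    ⬡₃ 3 10 7 12 15 16 ∷ ⬡₄ 1 12 7 10 3 16 ∷ by-lemma 0 (swap₂₃ ∷ flip₃ ∷ flip₂ ∷ []) ∷
    ⬡₁ 4 13 16 15 14 1 ∷ ⬡₃ 12 1 14 15 16 17 ∷ ⬡₃ 7 0 15 4 13 12 ∷ ⬡₂ 16 7 12 1 8 17 ∷
    ⬡₁ 2 5 8 7 14 1 ∷ ⬡₂ 8 5 12 1 14 17 ∷ ⬡₁ 5 4 13 12 7 2 ∷ ⬡₁ 5 4 15 12 7 2 ∷
    ⬡₃ 7 2 15 4 3 12 ∷ ⬡₃ 3 2 13 0 9 10 ∷ ⬡₃ 2 9 14 1 4 13 ∷ ⬡₃ 3 16 9 4 1 10 ∷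
    ⬡₁ 12 7 16 17 4 9 ∷ ⬡₂ 16 13 2 9 14 17 ∷ ⬡₁ 4 5 8 17 2 9 ∷ ⬡₁ 4 5 8 17 2 13 ∷
    ⬡₃ 8 9 14 7 16 13 ∷ []) ∷
  (red 0 5 ∷ red 0 13 ∷ red 3 10 ∷ red 3 16 ∷ red 5 10 ∷ blue 5 16 ∷ red 7 10 ∷ blue 10 17 ∷
   [] ,
    ⬡₅ 5 8 17 16 13 10 ∷ ⬡₂ 8 7 10 3 16 17 ∷ ⬡₄ 0 5 10 3 8 13 ∷ []) ∷
  (red 1 12 ∷ red 3 10 ∷ red 3 14 ∷ red 3 16 ∷ red 7 10 ∷ red 7 12 ∷ red 14 15 ∷ [] ,
    by-lemma 15 [] ∷ ⬡₃ 10 7 12 1 0 3 ∷ ⬡₃ 3 10 7 12 15 16 ∷ ⬡₁ 1 4 5 14 3 10 ∷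
    by-lemma 0 (swap₂₃ ∷ flip₃ ∷ flip₂ ∷ []) ∷ by-lemma 15 (swap₂₃ ∷ flip₃ ∷ flip₂ ∷ []) ∷
    ⬡₁ 1 4 5 14 7 0 ∷ ⬡₁ 1 4 5 14 7 12 ∷ ⬡₁ 1 4 13 14 7 0 ∷ ⬡₂ 15 12 5 0 13 16 ∷
    ⬡₁ 4 3 16 15 0 5 ∷ by-lemma 16 [] ∷ ⬡₁ 4 13 16 17 10 5 ∷ ⬡₁ 12 13 16 17 10 5 ∷
    ⬡₄ 4 15 14 7 12 17 ∷ []) ∷
  (blue 0 7 ∷ red 0 13 ∷ red 0 15 ∷ red 4 9 ∷ red 4 15 ∷ red 4 17 ∷ red 7 14 ∷ blue 9 16 ∷
   red 14 15 ∷ [] ,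
    ⬡₃ 4 15 14 7 8 17 ∷ ⬡₁ 0 13 16 17 4 9 ∷ ⬡₁ 7 16 13 0 15 8 ∷ ⬡₃ 13 0 17 4 7 8 ∷ []) ∷
  (red 3 10 ∷ red 3 14 ∷ red 3 16 ∷ red 4 15 ∷ red 7 10 ∷ blue 7 12 ∷ red 9 14 ∷ red 14 15 ∷
   [] ,
    ⬡₃ 3 14 15 4 7 16 ∷ ⬡₁ 4 13 12 9 14 7 ∷ ⬡₁ 10 13 12 15 14 7 ∷ ⬡₁ 12 13 16 7 14 9 ∷
    ⬡₄ 3 10 15 4 9 16 ∷ []) ∷
  (red 1 12 ∷ red 1 14 ∷ red 3 10 ∷ red 3 14 ∷ red 3 16 ∷ red 7 10 ∷ blue 7 12 ∷ red 14 15 ∷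
   [] ,
    ⬡₃ 1 14 3 10 9 12 ∷ by-lemma 19 [] ∷ ⬡₁ 4 1 12 15 10 7 ∷ ⬡₁ 4 13 12 15 14 7 ∷
    ⬡₁ 4 13 16 15 14 1 ∷ ⬡₁ 9 12 15 16 3 10 ∷ ⬡₁ 5 4 7 16 1 14 ∷ ⬡₁ 5 4 7 10 3 14 ∷
    by-lemma 15 (swap₂₃ ∷ flip₂ ∷ []) ∷ []) ∷
  (red 3 10 ∷ red 3 14 ∷ blue 4 15 ∷ red 5 10 ∷ red 7 10 ∷ blue 7 12 ∷ red 14 15 ∷ [] ,
    ⬡₁ 4 13 12 15 10 7 ∷ ⬡₁ 4 13 12 15 14 7 ∷ ⬡₅ 4 5 14 15 6 7 ∷ ⬡₁ 9 12 15 14 3 10 ∷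
    ⬡₅ 6 7 10 9 12 15 ∷ ⬡₄ 3 10 5 6 9 14 ∷ []) ∷
  (red 3 10 ∷ red 3 14 ∷ blue 4 15 ∷ red 7 10 ∷ blue 7 12 ∷ red 14 15 ∷ [] ,
    by-lemma 21 [] ∷ ⬡₁ 4 13 12 15 14 7 ∷ ⬡₁ 5 4 7 10 3 14 ∷ []) ∷
  (red 3 10 ∷ red 3 14 ∷ red 7 10 ∷ blue 7 12 ∷ red 14 15 ∷ [] ,
    by-lemma 22 [] ∷ ⬡₁ 12 13 16 7 10 3 ∷ ⬡₃ 3 14 15 4 7 16 ∷ by-lemma 19 [] ∷
    ⬡₁ 10 13 12 15 14 7 ∷ ⬡₂ 9 0 7 14 3 12 ∷ ⬡₂ 0 1 14 7 10 9 ∷ ⬡₁ 1 4 5 14 3 10 ∷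
    ⬡₂ 0 3 14 15 4 1 ∷ by-lemma 15 (swap₂₃ ∷ flip₃ ∷ flip₂ ∷ []) ∷ ⬡₁ 9 12 13 14 15 0 ∷
    ⬡₁ 12 13 16 7 10 5 ∷ ⬡₁ 1 4 5 14 3 16 ∷ ⬡₃ 0 5 10 3 12 13 ∷ ⬡₁ 0 1 2 5 10 3 ∷
    ⬡₅ 0 1 2 5 14 13 ∷ ⬡₁ 1 4 7 16 3 2 ∷ ⬡₃ 3 2 13 0 9 10 ∷ ⬡₁ 0 1 4 7 2 9 ∷
    ⬡₄ 3 10 15 4 9 16 ∷ by-lemma 18 [] ∷ ⬡₁ 4 13 16 17 10 5 ∷ ⬡₅ 3 4 5 8 17 16 ∷
    ⬡₅ 4 5 8 17 16 13 ∷ ⬡₁ 9 8 17 14 7 10 ∷ ⬡₃ 3 8 13 0 9 10 ∷ []) ∷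
  (red 0 15 ∷ blue 1 14 ∷ red 3 10 ∷ red 3 14 ∷ red 3 16 ∷ blue 5 16 ∷ red 7 10 ∷ red 7 14 ∷
   blue 9 14 ∷ red 14 15 ∷ [] ,
    ⬡₁ 9 12 13 14 15 0 ∷ ⬡₁ 1 4 5 14 3 10 ∷ by-lemma 23 [] ∷ ⬡₂ 0 3 14 7 12 9 ∷
    ⬡₁ 1 4 5 14 7 0 ∷ by-lemma 16 [] ∷ ⬡₃ 0 5 10 3 12 13 ∷
    by-lemma 20 (swap₂₃ ∷ flip₃ ∷ []) ∷ []) ∷
  (blue 1 14 ∷ red 3 10 ∷ red 3 14 ∷ red 3 16 ∷ red 4 15 ∷ blue 5 16 ∷ red 7 10 ∷ red 7 14 ∷
   red 14 15 ∷ [] ,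
    ⬡₁ 1 4 5 14 3 10 ∷ ⬡₂ 0 3 14 15 4 1 ∷ by-lemma 23 [] ∷ by-lemma 24 [] ∷
    ⬡₂ 0 9 14 7 10 1 ∷ by-lemma 1 (flip₂ ∷ []) ∷ ⬡₁ 1 4 5 14 7 0 ∷ by-lemma 16 [] ∷
    ⬡₃ 0 5 10 3 12 13 ∷ by-lemma 20 (swap₂₃ ∷ flip₃ ∷ []) ∷ []) ∷
  (blue 1 12 ∷ red 1 14 ∷ red 3 10 ∷ red 3 14 ∷ red 3 16 ∷ red 4 15 ∷ blue 5 16 ∷ red 7 12 ∷
   red 7 14 ∷ red 9 14 ∷ red 10 15 ∷ [] ,
    ⬡₁ 10 13 12 7 14 1 ∷ by-lemma 20 (flip₂ ∷ []) ∷ ⬡₁ 4 13 12 9 14 1 ∷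
    by-lemma 25 (swap₂₃ ∷ flip₃ ∷ flip₂ ∷ []) ∷ ⬡₄ 3 10 15 4 9 16 ∷ ⬡₃ 10 3 14 1 2 5 ∷
    ⬡₃ 10 7 14 1 2 5 ∷ ⬡₃ 4 9 14 7 16 17 ∷ ⬡₁ 1 4 13 16 3 2 ∷ ⬡₁ 1 4 9 12 7 2 ∷
    ⬡₅ 4 5 8 17 16 13 ∷ ⬡₂ 16 13 2 9 14 17 ∷ ⬡₃ 8 9 14 7 16 13 ∷ ⬡₁ 4 5 8 17 2 9 ∷ []) ∷
  (blue 0 5 ∷ red 0 7 ∷ red 0 13 ∷ red 0 15 ∷ red 4 15 ∷ red 7 14 ∷ [] ,
    ⬡₂ 5 4 15 0 7 8 ∷ ⬡₃ 7 0 13 8 5 14 ∷ ⬡₁ 13 16 17 8 15 0 ∷ ⬡₁ 13 16 17 8 15 4 ∷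
    ⬡₃ 7 0 17 4 5 14 ∷ []) ∷
  (red 0 15 ∷ blue 1 12 ∷ red 1 14 ∷ red 3 10 ∷ red 3 14 ∷ red 3 16 ∷ red 4 15 ∷ blue 5 16 ∷
   red 7 12 ∷ red 7 14 ∷ red 10 15 ∷ red 14 15 ∷ [] ,
    ⬡₁ 10 13 12 7 14 1 ∷ by-lemma 25 (swap₂₃ ∷ flip₃ ∷ flip₂ ∷ []) ∷ by-lemma 26 [] ∷
    ⬡₃ 10 3 14 1 2 5 ∷ ⬡₃ 10 7 14 1 2 5 ∷ by-lemma 26 (swap₂₃ ∷ flip₃ ∷ flip₂ ∷ []) ∷
    ⬡₁ 9 12 13 14 15 0 ∷ ⬡₂ 0 3 14 7 12 9 ∷ ⬡₃ 3 2 7 12 13 16 ∷ ⬡₅ 5 8 17 16 13 10 ∷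
    ⬡₄ 0 5 10 3 2 13 ∷ ⬡₃ 7 0 13 8 5 14 ∷ []) ∷
  (red 3 10 ∷ red 3 14 ∷ red 3 16 ∷ red 4 15 ∷ red 7 10 ∷ red 7 12 ∷ red 14 15 ∷ [] ,
    by-lemma 17 [] ∷ ⬡₃ 3 14 15 4 7 16 ∷ ⬡₃ 3 10 7 12 15 16 ∷
    by-lemma 25 (swap₂₃ ∷ flip₃ ∷ flip₂ ∷ []) ∷ by-lemma 17 (swap₂₃ ∷ flip₃ ∷ flip₂ ∷ []) ∷
    by-lemma 26 (swap₂₃ ∷ flip₃ ∷ flip₂ ∷ []) ∷ by-lemma 28 (swap₂₃ ∷ flip₃ ∷ flip₂ ∷ []) ∷
    ⬡₂ 8 5 10 15 14 17 ∷ []) ∷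
  (red 3 10 ∷ red 3 14 ∷ red 3 16 ∷ red 7 10 ∷ red 7 12 ∷ red 14 15 ∷ [] ,
    by-lemma 29 [] ∷ by-lemma 17 [] ∷ ⬡₃ 3 10 7 12 15 16 ∷ ⬡₁ 4 13 12 15 14 1 ∷
    by-lemma 0 (swap₂₃ ∷ flip₃ ∷ flip₂ ∷ []) ∷ by-lemma 17 (swap₂₃ ∷ flip₃ ∷ flip₂ ∷ []) ∷
    ⬡₁ 1 4 5 14 3 10 ∷ ⬡₁ 4 13 16 15 10 5 ∷ []) ∷
  (red 1 14 ∷ red 1 16 ∷ red 3 10 ∷ red 3 14 ∷ red 9 16 ∷ [] ,
    by-lemma 30 (swap₂₃ ∷ flip₂ ∷ []) ∷ ⬡₁ 12 13 14 1 16 9 ∷ ⬡₁ 12 13 16 1 14 3 ∷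
    by-lemma 23 (flip₂ ∷ []) ∷ []) ∷
  (blue 1 14 ∷ red 1 16 ∷ red 3 10 ∷ red 3 14 ∷ red 3 16 ∷ red 9 16 ∷ [] ,
    ⬡₁ 1 4 5 14 3 10 ∷ ⬡₁ 1 4 5 14 3 16 ∷ by-lemma 7 (swap₂₃ ∷ flip₂ ∷ []) ∷ []) ∷
  (red 3 10 ∷ red 3 14 ∷ red 3 16 ∷ red 7 12 ∷ red 14 15 ∷ [] ,
    by-lemma 31 (swap₂₃ ∷ flip₃ ∷ []) ∷ ⬡₁ 1 4 7 16 3 10 ∷ ⬡₁ 7 12 9 10 3 16 ∷
    by-lemma 31 [] ∷ by-lemma 32 [] ∷ []) ∷
  (red 1 14 ∷ red 3 10 ∷ red 3 14 ∷ red 3 16 ∷ red 4 15 ∷ blue 7 10 ∷ [] ,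
    ⬡₃ 3 10 15 4 7 16 ∷ ⬡₁ 1 4 7 16 3 10 ∷ ⬡₁ 9 12 15 16 3 10 ∷ by-lemma 31 [] ∷ []) ∷
  (red 1 14 ∷ red 3 10 ∷ red 3 14 ∷ red 3 16 ∷ blue 7 10 ∷ red 14 15 ∷ [] ,
    by-lemma 34 [] ∷ ⬡₁ 1 4 7 16 3 10 ∷ ⬡₁ 4 13 12 15 14 1 ∷ ⬡₃ 1 16 3 10 9 12 ∷
    by-lemma 31 [] ∷ []) ∷
  (red 3 10 ∷ red 3 14 ∷ red 3 16 ∷ red 14 15 ∷ [] ,
    by-lemma 33 [] ∷ by-lemma 23 [] ∷ ⬡₁ 1 4 7 16 3 10 ∷ by-lemma 35 [] ∷ ⬡₁ 1 4 5 14 3 10 ∷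
    by-lemma 32 [] ∷ ⬡₁ 1 4 5 14 3 16 ∷ ⬡₃ 1 16 3 10 9 12 ∷ ⬡₂ 0 1 16 5 10 9 ∷
    ⬡₅ 0 1 16 15 12 9 ∷ ⬡₄ 0 5 16 3 14 15 ∷ []) ∷
  (red 3 10 ∷ red 3 14 ∷ red 3 16 ∷ blue 4 15 ∷ red 7 10 ∷ blue 7 12 ∷ [] ,
    by-lemma 36 (flip₂ ∷ []) ∷ ⬡₅ 4 7 6 15 12 13 ∷ ⬡₁ 4 13 12 15 10 7 ∷ ⬡₁ 9 12 15 16 3 10 ∷
    ⬡₅ 6 7 10 9 12 15 ∷ ⬡₃ 6 9 16 3 4 13 ∷ ⬡₂ 14 13 6 9 16 17 ∷ ⬡₂ 5 4 9 6 13 14 ∷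
    ⬡₁ 5 4 9 10 3 14 ∷ ⬡₁ 12 3 14 17 6 9 ∷ ⬡₃ 6 5 10 3 12 9 ∷ ⬡₂ 15 6 5 10 7 16 ∷
    by-lemma 36 (flip₃ ∷ []) ∷ []) ∷
  (red 3 10 ∷ red 3 14 ∷ red 3 16 ∷ red 7 10 ∷ red 7 12 ∷ [] ,
    by-lemma 36 [] ∷ ⬡₃ 3 10 7 12 15 16 ∷ ⬡₃ 3 14 7 12 15 16 ∷ by-lemma 32 (flip₂ ∷ []) ∷ []) ∷
  (red 3 14 ∷ red 3 16 ∷ red 5 10 ∷ red 5 16 ∷ red 7 10 ∷ red 10 15 ∷ [] ,
    by-lemma 15 (swap₂₃ ∷ flip₃ ∷ flip₂ ∷ []) ∷ by-lemma 7 (swap₂₃ ∷ flip₃ ∷ flip₂ ∷ []) ∷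
    []) ∷
  (blue 1 14 ∷ red 3 10 ∷ red 3 14 ∷ red 3 16 ∷ red 4 15 ∷ red 5 16 ∷ red 7 10 ∷ [] ,
    ⬡₁ 1 4 5 14 3 10 ∷ by-lemma 39 [] ∷ ⬡₁ 1 4 15 16 3 10 ∷ ⬡₁ 9 12 15 16 3 10 ∷
    by-lemma 32 [] ∷ []) ∷
  (red 3 10 ∷ red 3 14 ∷ red 3 16 ∷ red 7 10 ∷ [] ,
    by-lemma 38 [] ∷ by-lemma 36 [] ∷ by-lemma 36 (flip₂ ∷ []) ∷ by-lemma 37 [] ∷
    ⬡₁ 5 4 15 16 3 14 ∷ by-lemma 40 [] ∷ ⬡₃ 1 14 3 10 9 12 ∷ ⬡₂ 12 3 14 1 6 15 ∷
    ⬡₅ 0 1 14 13 12 9 ∷ ⬡₃ 0 7 10 3 12 13 ∷ ⬡₁ 1 4 7 6 13 0 ∷ ⬡₂ 0 1 14 7 10 9 ∷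
    ⬡₅ 6 7 10 13 12 15 ∷ by-lemma 32 (flip₂ ∷ []) ∷ []) ∷
  (red 3 10 ∷ red 3 14 ∷ red 3 16 ∷ [] ,
    -- `flip₂` fixes 3 and 14 and exchanges 10 with 16 and 1 with 7, so a single pattern makes both
    -- 1 16 and 7 10 blue.
    by-lemma 41 (flip₂ ∷ []) ∷ by-lemma 41 [] ∷ ⬡₁ 1 4 7 16 3 10 ∷ []) ∷
  (red 1 12 ∷ red 1 14 ∷ blue 1 16 ∷ red 3 10 ∷ red 3 14 ∷ red 12 17 ∷ [] ,
    ⬡₁ 10 13 16 17 12 1 ∷ ⬡₄ 1 12 17 10 3 14 ∷ []) ∷
  (red 1 12 ∷ red 1 14 ∷ blue 1 16 ∷ red 3 10 ∷ red 3 14 ∷ red 4 17 ∷ red 6 13 ∷ red 6 17 ∷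
   [] ,
    by-lemma 43 [] ∷ ⬡₃ 4 17 6 13 12 15 ∷ ⬡₅ 1 4 17 16 15 12 ∷ []) ∷
  (red 1 14 ∷ red 3 10 ∷ red 3 14 ∷ blue 7 10 ∷ [] ,
    by-lemma 42 [] ∷ ⬡₁ 10 13 16 7 14 3 ∷ ⬡₅ 3 6 7 16 13 10 ∷ ⬡₅ 3 4 7 16 17 14 ∷
    ⬡₅ 3 6 7 16 17 14 ∷ ⬡₁ 3 4 7 16 1 14 ∷ by-lemma 44 [] ∷ ⬡₃ 6 1 14 3 12 13 ∷
    ⬡₂ 1 4 17 6 13 10 ∷ ⬡₃ 3 10 17 4 5 14 ∷ ⬡₁ 5 8 7 6 17 10 ∷
    by-lemma 27 (swap₂₃ ∷ flip₃ ∷ []) ∷ []) ∷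
  (red 3 10 ∷ red 3 14 ∷ red 7 10 ∷ [] ,
    by-lemma 42 [] ∷ ⬡₁ 14 13 16 7 10 3 ∷ ⬡₁ 12 13 16 7 10 3 ∷
    by-lemma 41 (swap₂₃ ∷ flip₃ ∷ flip₂ ∷ []) ∷ []) ∷
  (red 3 10 ∷ red 3 14 ∷ [] ,
    by-lemma 42 [] ∷ by-lemma 46 [] ∷ by-lemma 45 [] ∷ ⬡₁ 10 13 16 7 14 3 ∷
    ⬡₁ 1 4 5 14 3 10 ∷ ⬡₅ 3 4 7 16 17 14 ∷ ⬡₁ 1 4 17 14 3 10 ∷
    by-lemma 45 (swap₂₃ ∷ swap₁₂ ∷ flip₃ ∷ flip₁ ∷ []) ∷
    by-lemma 46 (swap₂₃ ∷ swap₁₂ ∷ flip₃ ∷ flip₁ ∷ []) ∷ []) ∷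
  (blue 1 14 ∷ red 3 14 ∷ [] ,
    by-lemma 47 [] ∷ ⬡₅ 0 1 10 11 14 3 ∷ ⬡₅ 0 1 10 13 14 3 ∷ ⬡₅ 1 4 3 14 11 10 ∷
    by-lemma 47 (swap₁₂ ∷ flip₃ ∷ []) ∷ ⬡₃ 0 11 4 9 12 13 ∷ ⬡₅ 3 4 11 10 9 12 ∷ []) ∷
  -- The vertices 3 and 14 are a knight's move apart in a plane through the centre. Refuting this
  -- pattern makes the whole orbit of the pair blue.
  (red 3 14 ∷ [] ,
    by-lemma 47 [] ∷ by-lemma 47 (flip₂ ∷ []) ∷ by-lemma 48 [] ∷ by-lemma 48 (flip₂ ∷ []) ∷
    by-lemma 48 (swap₂₃ ∷ flip₃ ∷ []) ∷ by-lemma 48 (swap₂₃ ∷ []) ∷ ⬡₁ 10 13 16 7 14 1 ∷ []) ∷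
  -- The vertices 1 and 14 are opposite corners of a unit cube. The closing hexagon lies in the unit
  -- cube spanned by 13 and 26, and its long diagonals are space diagonals of that cube.
  (red 1 14 ∷ [] ,
    by-lemma 49 (swap₂₃ ∷ []) ∷ by-lemma 49 (swap₂₃ ∷ flip₃ ∷ []) ∷
    by-lemma 49 (swap₂₃ ∷ flip₃ ∷ flip₁ ∷ []) ∷
    by-lemma 49 (swap₂₃ ∷ swap₁₂ ∷ flip₃ ∷ flip₁ ∷ []) ∷ by-lemma 49 (swap₁₃ ∷ swap₁₂ ∷ []) ∷
    by-lemma 49 (swap₁₃ ∷ swap₁₂ ∷ flip₃ ∷ []) ∷ by-lemma 49 (swap₁₃ ∷ flip₃ ∷ flip₁ ∷ []) ∷
    ⬡₁ 10 13 16 7 14 1 ∷ ⬡₁ 10 13 16 25 14 1 ∷ ⬡₁ 4 13 22 19 14 1 ∷ ⬡₅ 1 4 7 16 23 14 ∷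
    ⬡₅ 1 10 19 22 17 14 ∷ ⬡₅ 14 17 16 25 22 23 ∷ []) ∷
  ([] ,
    -- The three images make 7 12, 3 16 and 4 15 blue. These are the long diagonals of a six-cycle
    -- of grid edges in one unit cube, so they exceed `hi` while all six edges are at most `hi`.
    by-lemma 50 (flip₃ ∷ flip₂ ∷ []) ∷ by-lemma 50 (swap₂₃ ∷ []) ∷
    by-lemma 50 (swap₁₃ ∷ swap₁₂ ∷ flip₃ ∷ flip₁ ∷ []) ∷ ⬡₅ 3 4 7 16 15 12 ∷ []) ∷ []

theorem5p2 : ¬ IsPCG P₃□P₃□P₃
theorem5p2 pcg = realise pcg (verify-sound [] certificate tt)
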